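{- Let $\Phi\in\mathrm{End}(\mathcal{Q})$ and $n\ge0$. Suppose that $\Phi_n$ has the partitioning property (with set of equivalence classes $E$) and that the numbers $c_{\alpha,(n)}$, $\alpha\in\operatorname{Comp}(n)$, are nonnegative and not all zero. Then $\widehat{K}$ is a stochastic matrix and it lumps $K$ by equivalence classes: for all $A,B\in E$ and all $\pi,\tau\in\mathfrak{S}_n$ with $D(\pi),D(\tau)\in A$, $$\sum_{\sigma\in\mathfrak{S}_n:\,D(\sigma)\in B}K(\pi,\sigma)=\sum_{\sigma\in\mathfrak{S}_n:\,D(\sigma)\in B}K(\tau,\sigma)=\widehat{K}(A,B).$$
   Context: Work over $\mathbb{Q}$. Compositions $\alpha=(a_1,\dots,a_k)$ of $n$, $\operatorname{Comp}(n)$, $(n)$, $S_\alpha=\{a_1,\dots,a_1+\dots+a_{k-1}\}$, $\operatorname{co}$ its inverse, $\alpha\le\beta$ iff $S_\alpha\subseteq S_\beta$. $M_\alpha=\sum_{i_1<\dots<i_k}x_{i_1}^{a_1}\cdots x_{i_k}^{a_k}$, $\mathcal{Q}_n$ their span over $\operatorname{Comp}(n)$, $\mathcal{Q}$ the graded Hopf algebra of quasisymmetric functions (coproduct by deconcatenation of $M_\alpha$), $F_\alpha=\sum_{\beta\ge\alpha}M_\beta$. $\mathrm{End}(\mathcal{Q})$ = graded Hopf algebra endomorphisms, $\Phi_n=\Phi|_{\mathcal{Q}_n}$. For $\sigma\in\mathfrak{S}_n$, $D(\sigma)=\operatorname{co}(\{i:\sigma_i>\sigma_{i+1}\})$; product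 is composition. Define $c_{\alpha,\beta}$ by $\Phi(F_\alpha)=\sum_\beta c_{\alpha,\beta}F_\beta$, $\lambda$ by $\Phi(M_{(1)})=\lambda M_{(1)}$, $\mathrm{Prob}_\Phi(\pi)=c_{D(\pi),(n)}/\sum_\sigma c_{D(\sigma),(n)}$, $K(\pi,\sigma\pi)=\mathrm{Prob}_\Phi(\sigma^{ -1})$. $\Phi_n$ has the partitioning property if there is an equivalence relation on $\operatorname{Comp}(n)$, with set of classes $E$, such that $\Phi(F_\alpha)=\Phi(F_\beta)$ whenever $\alpha,\beta$ are equivalent, and, writing $\phi_A=\Phi(F_\alpha)$ for any $\alpha\in A\in E$, the family $\{\phi_A\}_{A\in E}$ is a basis of $\Phi(\mathcal{Q}_n)$. Then define $d_{A,B}$ by $\Phi(\phi_A)=\sum_{B\in E}d_{A,B}\phi_B$ and, when $\lambda^n\ne0$, $\widehat{K}(A,B)=d_{A,B}/\lambda^n$. -}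

module Defs where

open import Data.Nat as ℕ using (ℕ; zero; suc; _<ᵇ_)
open import Data.Bool using (Bool; true; false; if_then_else_; _∧_)
open import Data.Fin using (Fin)
open import Data.List using (List; []; _∷_; map; concatMap; _++_; foldr; length; upTo; allFin; filterᵇ)
open import Data.Bool.ListAction using (all; any)
open import Data.Nat.ListAction using (sum)
open import Data.List.Properties using (≡-dec)
open import Data.Product using (Σ; _×_; _,_; proj₁; proj₂)
open import Relation.Nullary.Decidable using (⌊_⌋)
open import Relation.Binary.PropositionalEquality using (_≡_; _≢_)
open import Data.Rational using (ℚ; 0ℚ; 1ℚ; _+_; _*_; _÷_)
open import Data.Rational.Properties using () renaming (_≟_ to _≟ℚ_)
open import Relation.Nullary using (yes; no)
open import Data.Rational.Base using (≢-nonZero)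
open import Data.List.Membership.Propositional using () renaming (_∈_ to _∈ᴸ_)

Σ[_]_ : {A : Set} → List A → (A → ℚ) → ℚ
Σ[ xs ] f = foldr (λ x acc → f x + acc) 0ℚ xs

Σ[_∣_]_ : {A : Set} → List A → (A → Bool) → (A → ℚ) → ℚ
Σ[ xs ∣ p ] f = Σ[ filterᵇ p xs ] f

infix 2 Σ[_]_ Σ[_∣_]_

_^ℚ_ : ℚ → ℕ → ℚ
q ^ℚ zero  = 1ℚ
q ^ℚ suc n = q * (q ^ℚ n)

-- division p / q (only ever used with q ≠ 0; returns 0 if q = 0)
divℚ : ℚ → ℚ → ℚ
divℚ p q with q ≟ℚ 0ℚ
... | yes _  = 0ℚ
... | no q≢0 = _÷_ p q {{≢-nonZero q≢0}}

-- Compositions, represented by their list of parts (a₁,…,a_k), aᵢ ≥ 1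

_==ᶜ_ : List ℕ → List ℕ → Bool
α ==ᶜ β = ⌊ ≡-dec ℕ._≟_ α β ⌋

-- Comp(n): all compositions of n (each exactly once).
-- Compositions of n+1 are obtained from those of n by prepending a part 1
-- or by increasing the first part.
comps : ℕ → List (List ℕ)
comps zero    = [] ∷ []
comps (suc n) = concatMap step (comps n)
  where
  step : List ℕ → List (List ℕ)
  step []      = (1 ∷ []) ∷ []
  step (a ∷ α) = (1 ∷ a ∷ α) ∷ (suc a ∷ α) ∷ []

size : List ℕ → ℕ
size = sum

top : ℕ → List ℕ
top zero    = []
top (suc n) = suc n ∷ []

partials : List ℕ → List ℕ
partials []      = []
partials (a ∷ α) = go a α
  where
  go : ℕ → List ℕ → List ℕ
  go s []      = []
  go s (b ∷ β) = s ∷ go (s ℕ.+ b) β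

_∈ᵇ_ : ℕ → List ℕ → Bool
x ∈ᵇ xs = any (λ y → ⌊ x ℕ.≟ y ⌋) xs

_≤ᶜ_ : List ℕ → List ℕ → Bool
α ≤ᶜ β = all (λ s → s ∈ᵇ partials β) (partials α)

-- Quasi-shuffles:  M_α M_β = Σ_{γ ∈ qsh α β} M_γ  (with multiplicity)

qsh : List ℕ → List ℕ → List (List ℕ)
qsh []      β       = β ∷ []
qsh (a ∷ α) []      = (a ∷ α) ∷ []
qsh (a ∷ α) (b ∷ β) =
  map (a ∷_) (qsh α (b ∷ β)) ++ map (b ∷_) (qsh (a ∷ α) β)
    ++ map ((a ℕ.+ b) ∷_) (qsh α β)

-- deconcatenations γ = γ₁ · γ₂ :  Δ M_γ = Σ M_{γ₁} ⊗ M_{γ₂}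
splits : List ℕ → List (List ℕ × List ℕ)
splits []      = ([] , []) ∷ []
splits (a ∷ γ) = ([] , a ∷ γ) ∷ map (λ p → (a ∷ proj₁ p , proj₂ p)) (splits γ)

δᶜ : List ℕ → List ℕ → ℚ
δᶜ α β = if α ==ᶜ β then 1ℚ else 0ℚ

-- Graded Hopf endomorphisms of QSym.
-- A graded linear map Φ : QSym → QSym is given by its matrix in the
-- monomial basis:  Φ(M_α) = Σ_{β ∈ Comp(|α|)} Φ α β · M_β.

record IsHopfEnd (Φ : List ℕ → List ℕ → ℚ) : Set where
  field
    unit : Φ [] [] ≡ 1ℚ
    -- Φ(M_α M_β) = Φ(M_α) Φ(M_β), compared coefficientwise on M_δ
    mult : ∀ a b α β δ → α ∈ᴸ comps a → β ∈ᴸ comps b → δ ∈ᴸ comps (a ℕ.+ b) →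
           (Σ[ qsh α β ] λ γ → Φ γ δ)
           ≡ (Σ[ comps a ] λ α′ → Σ[ comps b ] λ β′ →
                Φ α α′ * (Φ β β′ * (Σ[ qsh α′ β′ ] λ γ → δᶜ γ δ)))
    -- Δ(Φ(M_γ)) = (Φ ⊗ Φ)(Δ M_γ), compared coefficientwise on M_α ⊗ M_β
    comult : ∀ a b α β γ → α ∈ᴸ comps a → β ∈ᴸ comps b → γ ∈ᴸ comps (a ℕ.+ b) →
           (Σ[ comps (a ℕ.+ b) ] λ ε → Φ γ ε * δᶜ ε (α ++ β))
           ≡ (Σ[ splits γ ] λ p →
                Σ[ comps (size (proj₁ p)) ] λ α′ → Σ[ comps (size (proj₂ p)) ] λ β′ →
                  Φ (proj₁ p) α′ * (Φ (proj₂ p) β′ * (δᶜ α′ α * δᶜ β′ β)))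

-- Permutations of {0,…,n-1} in one-line notation σ = (σ(0),…,σ(n-1))

insertions : ℕ → List ℕ → List (List ℕ)
insertions x []       = (x ∷ []) ∷ []
insertions x (y ∷ ys) = (x ∷ y ∷ ys) ∷ map (y ∷_) (insertions x ys)

perms : ℕ → List (List ℕ)
perms zero    = [] ∷ []
perms (suc n) = concatMap (insertions n) (perms n)

at : List ℕ → ℕ → ℕ
at []       _       = 0
at (x ∷ xs) zero    = x
at (x ∷ xs) (suc j) = at xs j

indexOf : ℕ → List ℕ → ℕ
indexOf i []       = 0
indexOf i (x ∷ xs) = if ⌊ i ℕ.≟ x ⌋ then 0 else suc (indexOf i xs)

_∘ₚ_ : List ℕ → List ℕ → List ℕ
σ ∘ₚ τ = map (at σ) τ

inv : List ℕ → List ℕ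
inv σ = map (λ i → indexOf i σ) (upTo (length σ))

-- descent composition D(σ) = co({i : σ_i > σ_{i+1}}): lengths of the
-- maximal increasing runs of σ
D : List ℕ → List ℕ
D []      = []
D (x ∷ σ) = go x 1 σ
  where
  go : ℕ → ℕ → List ℕ → List ℕ
  go p k []      = k ∷ []
  go p k (y ∷ ys) = if y <ᵇ p then k ∷ go y 1 ys else go y (suc k) ys

-- coefficient of M_γ in Φ(F_α), where F_α = Σ_{β ≥ α} M_β (α ∈ Comp(n))
ΦF : (List ℕ → List ℕ → ℚ) → ℕ → List ℕ → List ℕ → ℚ
ΦF Φ n α γ = Σ[ comps n ∣ (α ≤ᶜ_) ] λ δ → Φ δ γ

-- c is the family with Φ(F_α) = Σ_β c_{α,β} F_β, compared on M_γ
IsFCoeffs : (List ℕ → List ℕ → ℚ) → ℕ → (List ℕ → List ℕ → ℚ) → Set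
IsFCoeffs Φ n c = ∀ α γ → α ∈ᴸ comps n → γ ∈ᴸ comps n →
  (Σ[ comps n ∣ (_≤ᶜ γ) ] λ β → c α β) ≡ ΦF Φ n α γ

lam : (List ℕ → List ℕ → ℚ) → ℚ
lam Φ = Φ (1 ∷ []) (1 ∷ [])

Prob : ℕ → (List ℕ → List ℕ → ℚ) → List ℕ → ℚ
Prob n c π = divℚ (c (D π) (top n)) (Σ[ perms n ] λ σ → c (D σ) (top n))

-- K(π, σπ) = Prob(σ⁻¹), i.e. K(π, τ) = Prob((τ π⁻¹)⁻¹)
K : ℕ → (List ℕ → List ℕ → ℚ) → List ℕ → List ℕ → ℚ
K n c π τ = Prob n c (inv (τ ∘ₚ inv π))

-- The partitioning property.  The equivalence relation on Comp(n) is
-- given by its quotient map cls : Comp(n) → E, with E = Fin k, together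
-- with a representative rep A ∈ A of each class (so every class is
-- nonempty, i.e. cls is onto E).  α ~ β  iff  cls α ≡ cls β.

record Partitioning (Φ : List ℕ → List ℕ → ℚ) (n : ℕ) : Set where
  field
    k   : ℕ
    cls : List ℕ → Fin k
    rep : Fin k → List ℕ
    rep∈  : ∀ A → rep A ∈ᴸ comps n
    repCls : ∀ A → cls (rep A) ≡ A

  φ : Fin k → List ℕ → ℚ
  φ A γ = ΦF Φ n (rep A) γ

  field
    constant : ∀ α β → α ∈ᴸ comps n → β ∈ᴸ comps n → cls α ≡ cls β →
               ∀ γ → γ ∈ᴸ comps n → ΦF Φ n α γ ≡ ΦF Φ n β γ
    independent : ∀ (a : Fin k → ℚ) →
      (∀ γ → γ ∈ᴸ comps n → (Σ[ allFin k ] λ A → a A * φ A γ) ≡ 0ℚ) →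
      ∀ A → a A ≡ 0ℚ
    spanning : ∀ (f : List ℕ → ℚ) → Σ (Fin k → ℚ) λ a →
      ∀ γ → γ ∈ᴸ comps n →
        (Σ[ comps n ] λ α → f α * Φ α γ) ≡ (Σ[ allFin k ] λ A → a A * φ A γ)

{-# OPTIONS --safe #-}
module Submission where

-- Write ψ(w) for the coefficient of M_(n) in Φ(F_D(w)), for a word w of length n with
-- distinct letters; for a permutation σ this is c_{D(σ),(n)}. Since F_u F_v is the sum
-- of F_w over the shuffles w of u and v, ψ is multiplicative: ψ(u) ψ(v) = Σ ψ(w). Since
-- the coproduct deconcatenates, the coefficient of M_γ in Φ(F_D(π)) is the product of
-- the ψ's of the consecutive segments of π of lengths γ₁, γ₂, …, hence the sum of ψ(ρ)
-- over the shuffles ρ of these segments, i.e. over the ρ with D(ρ⁻¹π) ≤ γ. With τ = ρ⁻¹π,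
--   Φ(F_D(π)) = Σ_τ ψ(πτ⁻¹) F_D(τ),
-- which is λⁿ Σ_τ K(π, τ) F_D(τ) because Σ_τ ψ(πτ⁻¹) is the coefficient for γ = (1,…,1),
-- namely λⁿ. Applying Φ once more and comparing coefficients in the basis φ gives the
-- lumping identity.

-- Words with arbitrary distinct letters replace permutations: the segments of π and their shuffles
-- are such words as they stand, so nothing has to be standardised. Inductions on size follow one
-- dichotomy. A composition of n+1 ≥ 2 is `1 ∷ ε` or `bump ε` for a composition ε of n, according to
-- whether a cut follows the first position, and D(x ∷ y ∷ w) arises from D(y ∷ w) in the same two
-- ways, according to whether x > y. The product rule for F_u F_v is the laborious part, because
-- quasi-shuffles may add parts while shuffles never merge letters. The two are reconciled by
-- reading a part as the length of an increasing block: a sum a + b joins a block of u to a block of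
-- v, and two increasing blocks on disjoint alphabets have exactly one increasing shuffle. The
-- coefficient of M_(n) is multiplicative because it is the evaluation at x₁ = 1 with all other
-- variables 0; following Φ by it gives another algebra map, and this is the source of ψ. That λⁿ is
-- positive comes out of the hypotheses on c: it is the sum of all c_{D(σ),(n)}, which are
-- nonnegative and, D being onto, not all zero.

open import Defs
open import Data.Bool using (Bool; true; false; if_then_else_; _∧_; _∨_; not; T)
open import Data.Bool.ListAction using (all)
open import Data.Bool.Properties using (T?)
open import Data.Empty using (⊥-elim)
open import Data.Fin using (Fin; _≟_)
open import Data.List
  using (List; []; _∷_; _++_; map; concatMap; filterᵇ; length; allFin; applyUpTo; downFrom; replicate; upTo)
open import Data.List.Membership.Propositional using (_∈_; _∉_; find; lose)
open import Data.List.Membership.Propositional.Properties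
open import Data.List.Membership.Propositional.Properties.WithK using (unique∧set⇒bag)
open import Data.List.Properties
  using (≡-dec; ∷-injectiveʳ; length-++; length-downFrom; length-upTo;
    map-∘; map-applyUpTo; map-cong-local; map-id; map-id-local; map-upTo; reverse-upTo)
open import Data.List.Relation.Binary.BagAndSetEquality using (∼bag⇒↭)
open import Data.List.Relation.Binary.Disjoint.Propositional using (Disjoint)
open import Data.List.Relation.Binary.Permutation.Propositional as Perm
  using (_↭_; ↭-refl; ↭-sym; ↭-trans; ↭-prep; ↭-swap; ↭-reflexive; ↭⇒↭ₛ)
open import Data.List.Relation.Binary.Permutation.Propositional.Properties
  using (∈-resp-↭; ↭-empty-inv; ↭-length; ↭-reverse; drop-mid) renaming (map⁺ to ↭-map⁺)
import Data.List.Relation.Binary.Permutation.Setoid.Properties as ↭ₛ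
open import Data.List.Relation.Unary.All as All using (All; []; _∷_)
import Data.List.Relation.Unary.All.Properties as All
open import Data.List.Relation.Unary.AllPairs as AllPairs using (AllPairs; []; _∷_)
import Data.List.Relation.Unary.AllPairs.Properties as AllPairs
open import Data.List.Relation.Unary.Any using (here; there)
open import Data.List.Relation.Unary.Unique.Propositional using (Unique)
import Data.List.Relation.Unary.Unique.Propositional.Properties as Unique
open import Data.Nat as ℕ using (ℕ; zero; suc; s≤s; _<ᵇ_; _≡ᵇ_)
open import Data.Nat.ListAction.Properties using (sum-++)
import Data.Nat.Properties as ℕ
open import Data.Product using (Σ; _×_; _,_; proj₁; proj₂; ∃-syntax)
open import Data.Rational
  using (ℚ; 0ℚ; 1ℚ; _+_; _*_; _-_; -_; 1/_; _≤_; _<_; positive; nonNegative; ≢-nonZero)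
import Data.Rational.Properties as ℚ
open import Data.Rational.Solver using (module +-*-Solver)
open import Data.Sum using (inj₁; inj₂)
open import Data.Unit using (tt)
open import Function using (_∘_; mk⇔)
open import Relation.Binary.Definitions using (DecidableEquality; tri<; tri≈; tri>)
open import Relation.Binary.PropositionalEquality
open import Relation.Nullary using (yes; no)
open import Relation.Nullary.Decidable using (⌊_⌋; isYes≗does)

open ≡-Reasoning

-- Finite rational sums

infixr 8 [_]·_

[_]·_ : Bool → ℚ → ℚ
[ b ]· q = if b then q else 0ℚ

[]·-∧ : ∀ b b′ q → [ b ∧ b′ ]· q ≡ [ b ]· [ b′ ]· q
[]·-∧ true  b′ q = refl
[]·-∧ false b′ q = refl

[]·-0 : ∀ b → [ b ]· 0ℚ ≡ 0ℚ
[]·-0 true  = refl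
[]·-0 false = refl

[]·-*ˡ : ∀ b p q → [ b ]· (p * q) ≡ p * [ b ]· q
[]·-*ˡ true  p q = refl
[]·-*ˡ false p q = sym (ℚ.*-zeroʳ p)

[]·-*ʳ : ∀ b p q → [ b ]· (p * q) ≡ ([ b ]· p) * q
[]·-*ʳ true  p q = refl
[]·-*ʳ false p q = sym (ℚ.*-zeroˡ q)

[]·-comm : ∀ b b′ q → [ b ]· [ b′ ]· q ≡ [ b′ ]· [ b ]· q
[]·-comm true  b′ q = refl
[]·-comm false b′ q = sym ([]·-0 b′)

+-interchange : ∀ p q r s → (p + q) + (r + s) ≡ (p + r) + (q + s)
+-interchange = solve 4 (λ p q r s → (p :+ q) :+ (r :+ s) := (p :+ r) :+ (q :+ s)) refl
  where open +-*-Solver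

private variable
  A B : Set

infix 2 ∑[_]_ ∑[_∣_]_

-- A copy of Σ[_]_ that does not unfold, so that unification can read off the summand.
opaque
  ∑[_]_ : List A → (A → ℚ) → ℚ
  ∑[ xs ] f = Σ[ xs ] f

∑[_∣_]_ : List A → (A → Bool) → (A → ℚ) → ℚ
∑[ xs ∣ p ] f = ∑[ filterᵇ p xs ] f

opaque
  unfolding ∑[_]_

  ∑≡Σ : ∀ (xs : List A) (f : A → ℚ) → (∑[ xs ] f) ≡ (Σ[ xs ] f)
  ∑≡Σ xs f = refl

  ∑-∷ : ∀ x (xs : List A) (f : A → ℚ) → (∑[ x ∷ xs ] f) ≡ f x + (∑[ xs ] f)
  ∑-∷ x xs f = refl

  ∑-[_] : ∀ x (f : A → ℚ) → (∑[ x ∷ [] ] f) ≡ f x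
  ∑-[ x ] f = ℚ.+-identityʳ (f x)

  ∑-cong : ∀ (xs : List A) {f g : A → ℚ} → (∀ x → x ∈ xs → f x ≡ g x) → (∑[ xs ] f) ≡ (∑[ xs ] g)
  ∑-cong []       eq = refl
  ∑-cong (x ∷ xs) eq = cong₂ _+_ (eq x (here refl)) (∑-cong xs λ y y∈ → eq y (there y∈))

  ∑-cong′ : ∀ (xs : List A) {f g : A → ℚ} → (∀ x → f x ≡ g x) → (∑[ xs ] f) ≡ (∑[ xs ] g)
  ∑-cong′ xs eq = ∑-cong xs λ x _ → eq x

  ∑-0 : ∀ (xs : List A) → (∑[ xs ] λ _ → 0ℚ) ≡ 0ℚ
  ∑-0 []       = refl
  ∑-0 (x ∷ xs) = trans (ℚ.+-identityˡ _) (∑-0 xs)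

  ∑-≡0 : ∀ (xs : List A) {f : A → ℚ} → (∀ x → x ∈ xs → f x ≡ 0ℚ) → (∑[ xs ] f) ≡ 0ℚ
  ∑-≡0 xs eq = trans (∑-cong xs eq) (∑-0 xs)

  ∑-++ : ∀ (xs ys : List A) (f : A → ℚ) → (∑[ xs ++ ys ] f) ≡ (∑[ xs ] f) + (∑[ ys ] f)
  ∑-++ []       ys f = sym (ℚ.+-identityˡ _)
  ∑-++ (x ∷ xs) ys f = trans (cong (f x +_) (∑-++ xs ys f)) (sym (ℚ.+-assoc (f x) _ _))

  ∑-map : ∀ (g : A → B) (xs : List A) (f : B → ℚ) → (∑[ map g xs ] f) ≡ (∑[ xs ] (f ∘ g))
  ∑-map g []       f = refl
  ∑-map g (x ∷ xs) f = cong (f (g x) +_) (∑-map g xs f)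

  ∑-concatMap : ∀ (g : A → List B) (xs : List A) (f : B → ℚ) →
    (∑[ concatMap g xs ] f) ≡ (∑[ xs ] λ x → ∑[ g x ] f)
  ∑-concatMap g []       f = refl
  ∑-concatMap g (x ∷ xs) f =
    trans (∑-++ (g x) (concatMap g xs) f) (cong ((∑[ g x ] f) +_) (∑-concatMap g xs f))

  ∑-filter : ∀ (p : A → Bool) (xs : List A) (f : A → ℚ) →
    (∑[ xs ∣ p ] f) ≡ (∑[ xs ] λ x → [ p x ]· f x)
  ∑-filter p []       f = refl
  ∑-filter p (x ∷ xs) f with p x
  ... | true  = cong (f x +_) (∑-filter p xs f)
  ... | false = trans (∑-filter p xs f) (sym (ℚ.+-identityˡ _))

  ∑-+ : ∀ (xs : List A) (f g : A → ℚ) → (∑[ xs ] λ x → f x + g x) ≡ (∑[ xs ] f) + (∑[ xs ] g)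
  ∑-+ []       f g = refl
  ∑-+ (x ∷ xs) f g =
    trans (cong ((f x + g x) +_) (∑-+ xs f g)) (+-interchange (f x) (g x) _ _)

  ∑-*ˡ : ∀ (xs : List A) p (f : A → ℚ) → (∑[ xs ] λ x → p * f x) ≡ p * (∑[ xs ] f)
  ∑-*ˡ []       p f = sym (ℚ.*-zeroʳ p)
  ∑-*ˡ (x ∷ xs) p f =
    trans (cong (p * f x +_) (∑-*ˡ xs p f)) (sym (ℚ.*-distribˡ-+ p (f x) _))

  ∑-*ʳ : ∀ (xs : List A) p (f : A → ℚ) → (∑[ xs ] λ x → f x * p) ≡ (∑[ xs ] f) * p
  ∑-*ʳ []       p f = sym (ℚ.*-zeroˡ p)
  ∑-*ʳ (x ∷ xs) p f =
    trans (cong (f x * p +_) (∑-*ʳ xs p f)) (sym (ℚ.*-distribʳ-+ p (f x) _))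

  ∑-[]· : ∀ b (xs : List A) (f : A → ℚ) → (∑[ xs ] λ x → [ b ]· f x) ≡ [ b ]· (∑[ xs ] f)
  ∑-[]· true  xs f = refl
  ∑-[]· false xs f = ∑-0 xs

  ∑-swap : ∀ (xs : List A) (ys : List B) (f : A → B → ℚ) →
    (∑[ xs ] λ x → ∑[ ys ] f x) ≡ (∑[ ys ] λ y → ∑[ xs ] λ x → f x y)
  ∑-swap []       ys f = sym (∑-0 ys)
  ∑-swap (x ∷ xs) ys f =
    trans (cong ((∑[ ys ] f x) +_) (∑-swap xs ys f))
          (sym (∑-+ ys (f x) λ y → ∑[ xs ] λ x′ → f x′ y))

  ∑-product : ∀ (xs : List A) (ys : List B) (f : A → ℚ) (g : B → ℚ) →
    (∑[ xs ] λ x → ∑[ ys ] λ y → f x * g y) ≡ (∑[ xs ] f) * (∑[ ys ] g)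
  ∑-product xs ys f g =
    trans (∑-cong′ xs λ x → ∑-*ˡ ys (f x) g) (∑-*ʳ xs (∑[ ys ] g) f)

  ∑-↭ : ∀ {xs ys : List A} (f : A → ℚ) → xs ↭ ys → (∑[ xs ] f) ≡ (∑[ ys ] f)
  ∑-↭ f Perm.refl         = refl
  ∑-↭ f (Perm.prep x p)   = cong (f x +_) (∑-↭ f p)
  ∑-↭ f (Perm.swap {xs} {ys} x y p) = begin
    f x + (f y + (∑[ xs ] f)) ≡⟨ ℚ.+-assoc (f x) (f y) _ ⟨
    (f x + f y) + (∑[ xs ] f) ≡⟨ cong₂ _+_ (ℚ.+-comm (f x) (f y)) (∑-↭ f p) ⟩
    (f y + f x) + (∑[ ys ] f) ≡⟨ ℚ.+-assoc (f y) (f x) _ ⟩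
    f y + (f x + (∑[ ys ] f)) ∎
  ∑-↭ f (Perm.trans p q)  = trans (∑-↭ f p) (∑-↭ f q)

  ∑-nonneg : ∀ (xs : List A) {f : A → ℚ} → (∀ x → x ∈ xs → 0ℚ ≤ f x) → 0ℚ ≤ (∑[ xs ] f)
  ∑-nonneg []       f≥0 = ℚ.≤-refl
  ∑-nonneg (x ∷ xs) f≥0 =
    ℚ.+-mono-≤ (f≥0 x (here refl)) (∑-nonneg xs λ y y∈ → f≥0 y (there y∈))

  term≤∑ : ∀ (xs : List A) {f : A → ℚ} → (∀ x → x ∈ xs → 0ℚ ≤ f x) →
    ∀ {y} → y ∈ xs → f y ≤ (∑[ xs ] f)
  term≤∑ (x ∷ xs) {f} f≥0 (here refl) =
    ℚ.≤-trans (ℚ.≤-reflexive (sym (ℚ.+-identityʳ (f x))))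
      (ℚ.+-monoʳ-≤ (f x) (∑-nonneg xs λ y y∈ → f≥0 y (there y∈)))
  term≤∑ (x ∷ xs) {f} f≥0 {y} (there y∈) =
    ℚ.≤-trans (ℚ.≤-reflexive (sym (ℚ.+-identityˡ (f y))))
      (ℚ.+-mono-≤ (f≥0 x (here refl)) (term≤∑ xs (λ z z∈ → f≥0 z (there z∈)) y∈))

-- Compositions and the order ≤ᶜ

-- The second way in which `comps` extends a composition: no cut after the new first position. The
-- value at `[]` is a placeholder.
bump : List ℕ → List ℕ
bump []      = []
bump (a ∷ α) = suc a ∷ α

-- Membership in `comps` in a form that peels off whole parts, whereas `comps` itself grows the
-- first part by units. Storing `a` for the part `suc a` makes every part positive.
data IsComp : ℕ → List ℕ → Set where
  []  : IsComp 0 []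
  _∷_ : ∀ a {m α} → IsComp m α → IsComp (suc a ℕ.+ m) (suc a ∷ α)

∈comps⇒IsComp : ∀ n {α} → α ∈ comps n → IsComp n α
∈comps⇒IsComp zero    (here refl) = []
∈comps⇒IsComp (suc n) α∈ with find (∈-concatMap⁻ _ {xs = comps n} α∈)
... | β , β∈ , α∈step with ∈comps⇒IsComp n β∈ | α∈step
... | []    | here refl         = 0 ∷ []
... | b ∷ p | here refl         = 0 ∷ (b ∷ p)
... | b ∷ p | there (here refl) = suc b ∷ p

IsComp⇒∈comps : ∀ {n α} → IsComp n α → α ∈ comps n
IsComp⇒∈comps []            = here refl
IsComp⇒∈comps (zero ∷ [])   = here refl
IsComp⇒∈comps (zero ∷ p@(_ ∷ _)) =
  ∈-concatMap⁺ _ (lose (IsComp⇒∈comps p) (here refl))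
IsComp⇒∈comps (suc a ∷ p) =
  ∈-concatMap⁺ _ (lose (IsComp⇒∈comps (a ∷ p)) (there (here refl)))

IsComp-size : ∀ {n α} → IsComp n α → size α ≡ n
IsComp-size []      = refl
IsComp-size (a ∷ p) = cong (suc a ℕ.+_) (IsComp-size p)

IsComp-bump : ∀ {n α} → IsComp (suc n) α → IsComp (suc (suc n)) (bump α)
IsComp-bump (a ∷ p) = suc a ∷ p

IsComp-top : ∀ n → IsComp n (top n)
IsComp-top zero    = []
IsComp-top (suc n) = subst (λ m → IsComp m (suc n ∷ [])) (ℕ.+-identityʳ (suc n)) (n ∷ [])

-- Starts at size 2 because `comps 0` contains only `[]`, which has a single extension; every
-- nonempty composition has exactly two.
∑-comps-suc : ∀ n (f : List ℕ → ℚ) →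
  (∑[ comps (2 ℕ.+ n) ] f) ≡ (∑[ comps (1 ℕ.+ n) ] λ δ → f (1 ∷ δ) + f (bump δ))
-- The local `step` of `comps` cannot be named here, so `go` accepts any function with its equation
-- on nonempty lists and unification supplies it.
∑-comps-suc n f = go _ λ _ _ → refl
  where
  go : ∀ step → (∀ a α → step (a ∷ α) ≡ (1 ∷ a ∷ α) ∷ (suc a ∷ α) ∷ []) →
    (∑[ concatMap step (comps (1 ℕ.+ n)) ] f) ≡ (∑[ comps (1 ℕ.+ n) ] λ δ → f (1 ∷ δ) + f (bump δ))
  go step step-∷ = trans (∑-concatMap step (comps (1 ℕ.+ n)) f)
    (∑-cong (comps (1 ℕ.+ n)) λ δ δ∈ → pointwise (∈comps⇒IsComp (1 ℕ.+ n) δ∈))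
    where
    pointwise : ∀ {m δ} → IsComp (suc m) δ → (∑[ step δ ] f) ≡ f (1 ∷ δ) + f (bump δ)
    pointwise (_∷_ a {α = α} p) =
      trans (cong (λ δs → ∑[ δs ] f) (step-∷ (suc a) α))
        (trans (∑-∷ _ _ f) (cong (f (1 ∷ suc a ∷ α) +_) (∑-[ _ ] f)))

δᶜ-refl : ∀ α → δᶜ α α ≡ 1ℚ
δᶜ-refl α with ≡-dec ℕ._≟_ α α
... | yes _   = refl
... | no  α≢α = ⊥-elim (α≢α refl)

*-δᶜ-refl : ∀ (f : List ℕ → ℚ) α → f α * δᶜ α α ≡ f α
*-δᶜ-refl f α = trans (cong (f α *_) (δᶜ-refl α)) (ℚ.*-identityʳ (f α))

δᶜ-≢ : ∀ {α β} → α ≢ β → δᶜ α β ≡ 0ℚ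
δᶜ-≢ {α} {β} α≢β with ≡-dec ℕ._≟_ α β
... | yes α≡β = ⊥-elim (α≢β α≡β)
... | no  _   = refl

δᶜ-injective : ∀ (g : List ℕ → List ℕ) α β → (g α ≡ g β → α ≡ β) → δᶜ (g α) (g β) ≡ δᶜ α β
δᶜ-injective g α β g-inj with ≡-dec ℕ._≟_ α β
... | yes refl = δᶜ-refl (g α)
... | no  α≢β  = δᶜ-≢ (α≢β ∘ g-inj)

bump-injective : ∀ {n m α β} → IsComp (suc n) α → IsComp (suc m) β → bump α ≡ bump β → α ≡ β
bump-injective (a ∷ p) (b ∷ q) refl = refl

-- Expresses that `comps n` lists `α` exactly once. Of the two extensions of `ε`, only `1 ∷ ε` can
-- equal a composition with first part 1, and only `bump ε` one with a larger first part.
∑-comps-δ : ∀ {n α} (f : List ℕ → ℚ) → IsComp n α → (∑[ comps n ] λ ε → f ε * δᶜ ε α) ≡ f α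
∑-comps-δ f []          = trans (∑-[ _ ] _) (*-δᶜ-refl f [])
∑-comps-δ f (zero ∷ []) = trans (∑-[ _ ] _) (*-δᶜ-refl f (1 ∷ []))
∑-comps-δ {α = α} f (zero ∷ p@(_∷_ b {m} {β} q)) = begin
  (∑[ comps (2 ℕ.+ (b ℕ.+ m)) ] λ ε → f ε * δᶜ ε α)
    ≡⟨ ∑-comps-suc (b ℕ.+ m) _ ⟩
  (∑[ comps (1 ℕ.+ (b ℕ.+ m)) ] λ ε → f (1 ∷ ε) * δᶜ (1 ∷ ε) α + f (bump ε) * δᶜ (bump ε) α)
    ≡⟨ ∑-cong (comps (1 ℕ.+ (b ℕ.+ m))) (λ ε ε∈ → pointwise (∈comps⇒IsComp (1 ℕ.+ (b ℕ.+ m)) ε∈)) ⟩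
  (∑[ comps (1 ℕ.+ (b ℕ.+ m)) ] λ ε → f (1 ∷ ε) * δᶜ ε (suc b ∷ β))
    ≡⟨ ∑-comps-δ (f ∘ (1 ∷_)) p ⟩
  f α ∎
  where
  pointwise : ∀ {k ε} → IsComp (suc k) ε →
    f (1 ∷ ε) * δᶜ (1 ∷ ε) α + f (bump ε) * δᶜ (bump ε) α ≡ f (1 ∷ ε) * δᶜ ε (suc b ∷ β)
  pointwise {ε = ε} (c ∷ r) = trans
    (cong₂ _+_ (cong (f (1 ∷ ε) *_) (δᶜ-injective (1 ∷_) ε (suc b ∷ β) ∷-injectiveʳ))
               (trans (cong (f (bump ε) *_) (δᶜ-≢ {bump ε} {α} λ ())) (ℚ.*-zeroʳ (f (bump ε)))))
    (ℚ.+-identityʳ _)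
∑-comps-δ {α = α} f (_∷_ (suc a) {m} {β} p) = begin
  (∑[ comps (2 ℕ.+ (a ℕ.+ m)) ] λ ε → f ε * δᶜ ε α)
    ≡⟨ ∑-comps-suc (a ℕ.+ m) _ ⟩
  (∑[ comps (1 ℕ.+ (a ℕ.+ m)) ] λ ε → f (1 ∷ ε) * δᶜ (1 ∷ ε) α + f (bump ε) * δᶜ (bump ε) α)
    ≡⟨ ∑-cong (comps (1 ℕ.+ (a ℕ.+ m))) (λ ε ε∈ → pointwise (∈comps⇒IsComp (1 ℕ.+ (a ℕ.+ m)) ε∈)) ⟩
  (∑[ comps (1 ℕ.+ (a ℕ.+ m)) ] λ ε → f (bump ε) * δᶜ ε (suc a ∷ β))
    ≡⟨ ∑-comps-δ (f ∘ bump) (a ∷ p) ⟩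
  f α ∎
  where
  pointwise : ∀ {k ε} → IsComp (suc k) ε →
    f (1 ∷ ε) * δᶜ (1 ∷ ε) α + f (bump ε) * δᶜ (bump ε) α ≡ f (bump ε) * δᶜ ε (suc a ∷ β)
  pointwise {ε = ε} q = trans
    (cong₂ _+_ (trans (cong (f (1 ∷ ε) *_) (δᶜ-≢ {1 ∷ ε} {α} λ ())) (ℚ.*-zeroʳ (f (1 ∷ ε))))
               (cong (f (bump ε) *_) (δᶜ-injective bump ε (suc a ∷ β) (bump-injective q (a ∷ p)))))
    (ℚ.+-identityˡ _)

-- The local functions of D and partials have no name outside Defs. Abstracting
-- the compound arguments leaves a call on distinct variables, from which
-- unification recovers them.
mutual
  D-go : ℕ → List ℕ → ℕ → ℕ → List ℕ → List ℕ
  D-go = _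

  D-go-solve : ∀ x y w →
    D (x ∷ y ∷ w) ≡ (if y <ᵇ x then 1 ∷ D-go x (y ∷ w) y 1 w else D-go x (y ∷ w) y 2 w)
  D-go-solve x y w with y ∷ w | 1 | 2
  ... | σ | k | l = refl

mutual
  partials-go : ℕ → List ℕ → ℕ → List ℕ → List ℕ
  partials-go = _

  partials-go-solve : ∀ a b α → partials (a ∷ b ∷ α) ≡ a ∷ partials-go a (b ∷ α) (a ℕ.+ b) α
  partials-go-solve a b α with b ∷ α | a ℕ.+ b
  ... | σ | s = refl

runs : ℕ → ℕ → List ℕ → List ℕ
runs p k []       = k ∷ []
runs p k (y ∷ ys) = if y <ᵇ p then k ∷ runs y 1 ys else runs y (suc k) ys

D-go≡runs : ∀ x σ p k w → D-go x σ p k w ≡ runs p k w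
D-go≡runs x σ p k []      = refl
D-go≡runs x σ p k (y ∷ w) =
  cong₂ (if y <ᵇ p then_else_) (cong (k ∷_) (D-go≡runs x σ y 1 w)) (D-go≡runs x σ y (suc k) w)

-- The accumulator enters the first part only.
runs-suc : ∀ p k w → runs p (suc k) w ≡ bump (runs p k w)
runs-suc p k []      = refl
runs-suc p k (y ∷ w) with y <ᵇ p
... | true  = refl
... | false = runs-suc y (suc k) w

-- Replaces the accumulator of `D` by a recursion from the front that matches `∑-comps-suc`: a
-- descent at the start cuts off a part 1, otherwise `x` joins the first run.
D-∷∷ : ∀ x y w → D (x ∷ y ∷ w) ≡ (if y <ᵇ x then 1 ∷ D (y ∷ w) else bump (D (y ∷ w)))
D-∷∷ x y w = cong₂ (if y <ᵇ x then_else_)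
  (cong (1 ∷_) (trans (D-go≡runs x (y ∷ w) y 1 w) (sym D≡runs)))
  (trans (D-go≡runs x (y ∷ w) y 2 w) (trans (runs-suc y 1 w) (cong bump (sym D≡runs))))
  where
  D≡runs : D (y ∷ w) ≡ runs y 1 w
  D≡runs = D-go≡runs y w y 1 w

IsComp-D : ∀ w → IsComp (length w) (D w)
IsComp-D []          = []
IsComp-D (x ∷ [])    = 0 ∷ []
IsComp-D (x ∷ y ∷ w) = subst (IsComp (2 ℕ.+ length w)) (sym (D-∷∷ x y w)) (go (IsComp-D (y ∷ w)) (y <ᵇ x))
  where
  go : ∀ {n α} → IsComp (suc n) α → ∀ b → IsComp (suc (suc n)) (if b then 1 ∷ α else bump α)
  go p true  = 0 ∷ p
  go p false = IsComp-bump p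

D∈comps : ∀ w → D w ∈ comps (length w)
D∈comps w = IsComp⇒∈comps (IsComp-D w)

-- Cut sets and their inclusion

partialsFrom : ℕ → List ℕ → List ℕ
partialsFrom s []      = []
partialsFrom s (b ∷ β) = s ∷ partialsFrom (s ℕ.+ b) β

partials-∷ : ∀ a α → partials (a ∷ α) ≡ partialsFrom a α
partials-∷ a α = go a α
  where
  go : ∀ s β → partials-go a α s β ≡ partialsFrom s β
  go s []      = refl
  go s (b ∷ β) = cong (s ∷_) (go (s ℕ.+ b) β)

partialsFrom-suc : ∀ s β → partialsFrom (suc s) β ≡ map suc (partialsFrom s β)
partialsFrom-suc s []      = refl
partialsFrom-suc s (b ∷ β) = cong (suc s ∷_) (partialsFrom-suc (s ℕ.+ b) β)

_⊆ᵇ_ : List ℕ → List ℕ → Bool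
xs ⊆ᵇ ys = all (_∈ᵇ ys) xs

suc-≟ : ∀ x y → ⌊ suc x ℕ.≟ suc y ⌋ ≡ ⌊ x ℕ.≟ y ⌋
suc-≟ x y = trans (isYes≗does (suc x ℕ.≟ suc y)) (sym (isYes≗does (x ℕ.≟ y)))

suc-∈ᵇ : ∀ x ys → suc x ∈ᵇ map suc ys ≡ x ∈ᵇ ys
suc-∈ᵇ x []       = refl
suc-∈ᵇ x (y ∷ ys) = cong₂ _∨_ (suc-≟ x y) (suc-∈ᵇ x ys)

zero-∈ᵇ : ∀ ys → 0 ∈ᵇ map suc ys ≡ false
zero-∈ᵇ []       = refl
zero-∈ᵇ (y ∷ ys) = zero-∈ᵇ ys

map-suc-⊆ᵇ : ∀ xs ys → map suc xs ⊆ᵇ map suc ys ≡ xs ⊆ᵇ ys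
map-suc-⊆ᵇ []       ys = refl
map-suc-⊆ᵇ (x ∷ xs) ys = cong₂ _∧_ (suc-∈ᵇ x ys) (map-suc-⊆ᵇ xs ys)

map-suc-⊆ᵇ-0∷ : ∀ xs ys → map suc xs ⊆ᵇ (0 ∷ map suc ys) ≡ xs ⊆ᵇ ys
map-suc-⊆ᵇ-0∷ []       ys = refl
map-suc-⊆ᵇ-0∷ (x ∷ xs) ys = cong₂ _∧_ (suc-∈ᵇ x ys) (map-suc-⊆ᵇ-0∷ xs ys)

-- Once every cut set is written as an image under `suc`, the common shift can be stripped from both
-- sides of an inclusion; a cut at 1 becomes the element 0.
partials-suc∷ : ∀ a α → partials (suc a ∷ α) ≡ map suc (partialsFrom a α)
partials-suc∷ a α = trans (partials-∷ (suc a) α) (partialsFrom-suc a α)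

partials-1∷ : ∀ a α → partials (1 ∷ suc a ∷ α) ≡ map suc (0 ∷ map suc (partialsFrom a α))
partials-1∷ a α = begin
  partials (1 ∷ suc a ∷ α)                ≡⟨ partials-∷ 1 (suc a ∷ α) ⟩
  1 ∷ partialsFrom (suc (suc a)) α        ≡⟨ cong (1 ∷_) (partialsFrom-suc (suc a) α) ⟩
  1 ∷ map suc (partialsFrom (suc a) α)    ≡⟨ cong (λ ps → 1 ∷ map suc ps) (partialsFrom-suc a α) ⟩
  map suc (0 ∷ map suc (partialsFrom a α)) ∎

partials-bump : ∀ a α → partials (bump (suc a ∷ α)) ≡ map suc (map suc (partialsFrom a α))
partials-bump a α = trans (partials-suc∷ (suc a) α) (cong (map suc) (partialsFrom-suc a α))

-- With S the cut set, S(1 ∷ α) is {1} together with S(α) + 1, and S(bump α) is S(α) + 1. This and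
-- the next three comparisons are read off from these two formulas.
1∷≤1∷ : ∀ {n m α β} → IsComp (suc n) α → IsComp (suc m) β → (1 ∷ α) ≤ᶜ (1 ∷ β) ≡ α ≤ᶜ β
1∷≤1∷ (_∷_ a {α = α′} _) (_∷_ b {α = β′} _) = begin
  (1 ∷ suc a ∷ α′) ≤ᶜ (1 ∷ suc b ∷ β′)
    ≡⟨ cong₂ _⊆ᵇ_ (partials-1∷ a α′) (partials-1∷ b β′) ⟩
  map suc (0 ∷ map suc (partialsFrom a α′)) ⊆ᵇ map suc (0 ∷ map suc (partialsFrom b β′))
    ≡⟨ map-suc-⊆ᵇ (0 ∷ map suc (partialsFrom a α′)) (0 ∷ map suc (partialsFrom b β′)) ⟩
  map suc (partialsFrom a α′) ⊆ᵇ (0 ∷ map suc (partialsFrom b β′))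
    ≡⟨ map-suc-⊆ᵇ-0∷ (partialsFrom a α′) (partialsFrom b β′) ⟩
  partialsFrom a α′ ⊆ᵇ partialsFrom b β′
    ≡⟨ map-suc-⊆ᵇ (partialsFrom a α′) (partialsFrom b β′) ⟨
  map suc (partialsFrom a α′) ⊆ᵇ map suc (partialsFrom b β′)
    ≡⟨ cong₂ _⊆ᵇ_ (partials-suc∷ a α′) (partials-suc∷ b β′) ⟨
  (suc a ∷ α′) ≤ᶜ (suc b ∷ β′) ∎

bump≤1∷ : ∀ {n m α β} → IsComp (suc n) α → IsComp (suc m) β → bump α ≤ᶜ (1 ∷ β) ≡ α ≤ᶜ β
bump≤1∷ (_∷_ a {α = α′} _) (_∷_ b {α = β′} _) = begin
  bump (suc a ∷ α′) ≤ᶜ (1 ∷ suc b ∷ β′)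
    ≡⟨ cong₂ _⊆ᵇ_ (partials-bump a α′) (partials-1∷ b β′) ⟩
  map suc (map suc (partialsFrom a α′)) ⊆ᵇ map suc (0 ∷ map suc (partialsFrom b β′))
    ≡⟨ map-suc-⊆ᵇ (map suc (partialsFrom a α′)) (0 ∷ map suc (partialsFrom b β′)) ⟩
  map suc (partialsFrom a α′) ⊆ᵇ (0 ∷ map suc (partialsFrom b β′))
    ≡⟨ map-suc-⊆ᵇ-0∷ (partialsFrom a α′) (partialsFrom b β′) ⟩
  partialsFrom a α′ ⊆ᵇ partialsFrom b β′
    ≡⟨ map-suc-⊆ᵇ (partialsFrom a α′) (partialsFrom b β′) ⟨
  map suc (partialsFrom a α′) ⊆ᵇ map suc (partialsFrom b β′)
    ≡⟨ cong₂ _⊆ᵇ_ (partials-suc∷ a α′) (partials-suc∷ b β′) ⟨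
  (suc a ∷ α′) ≤ᶜ (suc b ∷ β′) ∎

bump≤bump : ∀ {n m α β} → IsComp (suc n) α → IsComp (suc m) β → bump α ≤ᶜ bump β ≡ α ≤ᶜ β
bump≤bump (_∷_ a {α = α′} _) (_∷_ b {α = β′} _) = begin
  bump (suc a ∷ α′) ≤ᶜ bump (suc b ∷ β′)
    ≡⟨ cong₂ _⊆ᵇ_ (partials-bump a α′) (partials-bump b β′) ⟩
  map suc (map suc (partialsFrom a α′)) ⊆ᵇ map suc (map suc (partialsFrom b β′))
    ≡⟨ map-suc-⊆ᵇ (map suc (partialsFrom a α′)) (map suc (partialsFrom b β′)) ⟩
  map suc (partialsFrom a α′) ⊆ᵇ map suc (partialsFrom b β′)
    ≡⟨ cong₂ _⊆ᵇ_ (partials-suc∷ a α′) (partials-suc∷ b β′) ⟨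
  (suc a ∷ α′) ≤ᶜ (suc b ∷ β′) ∎

1∷≰bump : ∀ {n m α β} → IsComp (suc n) α → IsComp (suc m) β → (1 ∷ α) ≤ᶜ bump β ≡ false
1∷≰bump (_∷_ a {α = α′} _) (_∷_ b {α = β′} _) = begin
  (1 ∷ suc a ∷ α′) ≤ᶜ bump (suc b ∷ β′)
    ≡⟨ cong₂ _⊆ᵇ_ (partials-1∷ a α′) (partials-bump b β′) ⟩
  map suc (0 ∷ map suc (partialsFrom a α′)) ⊆ᵇ map suc (map suc (partialsFrom b β′))
    ≡⟨ map-suc-⊆ᵇ (0 ∷ map suc (partialsFrom a α′)) (map suc (partialsFrom b β′)) ⟩
  (0 ∷ map suc (partialsFrom a α′)) ⊆ᵇ map suc (partialsFrom b β′)
    ≡⟨ cong (_∧ (map suc (partialsFrom a α′) ⊆ᵇ map suc (partialsFrom b β′))) (zero-∈ᵇ (partialsFrom b β′)) ⟩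
  false ∎

-- Refinements of a descent composition

infix 4 _≤?ᵇ_

-- Defined as the negation of the descent test of `D`, so that one case split on `y <ᵇ x` settles
-- both.
_≤?ᵇ_ : ℕ → ℕ → Bool
x ≤?ᵇ y = not (y <ᵇ x)

-- The cut after `x` admits a descent there without forcing one, so the comparison of `x` with `y`
-- disappears.
D≤1∷ : ∀ x y w {m β} → IsComp (suc m) β → D (x ∷ y ∷ w) ≤ᶜ (1 ∷ β) ≡ D (y ∷ w) ≤ᶜ β
D≤1∷ x y w {β = β} q rewrite D-∷∷ x y w with y <ᵇ x
... | true  = 1∷≤1∷ (IsComp-D (y ∷ w)) q
... | false = bump≤1∷ (IsComp-D (y ∷ w)) q

D≤bump : ∀ x y w {m β} → IsComp (suc m) β →
  D (x ∷ y ∷ w) ≤ᶜ bump β ≡ (x ≤?ᵇ y) ∧ (D (y ∷ w) ≤ᶜ β)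
D≤bump x y w {β = β} q rewrite D-∷∷ x y w with y <ᵇ x
... | true  = 1∷≰bump (IsComp-D (y ∷ w)) q
... | false = bump≤bump (IsComp-D (y ∷ w)) q

-- The monomials of F_D(w). A function `f` on compositions stands for the linear functional sending
-- M_δ to `f δ`, and its sum over `refinements w` is the value at F_D(w).
refinements : List ℕ → List (List ℕ)
refinements w = filterᵇ (D w ≤ᶜ_) (comps (length w))

∈refinements⇒IsComp : ∀ w {δ} → δ ∈ refinements w → IsComp (length w) δ
∈refinements⇒IsComp w {δ} δ∈ =
  ∈comps⇒IsComp (length w) (proj₁ (∈-filter⁻ (T? ∘ (D w ≤ᶜ_)) {xs = comps (length w)} δ∈))

∑-refinements-∷∷ : ∀ x y w (f : List ℕ → ℚ) →
  (∑[ refinements (x ∷ y ∷ w) ] f)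
  ≡ (∑[ refinements (y ∷ w) ] (f ∘ (1 ∷_))) + [ x ≤?ᵇ y ]· (∑[ refinements (y ∷ w) ] (f ∘ bump))
∑-refinements-∷∷ x y w f = begin
  (∑[ refinements (x ∷ y ∷ w) ] f)
    ≡⟨ ∑-filter (D (x ∷ y ∷ w) ≤ᶜ_) (comps (2 ℕ.+ length w)) f ⟩
  (∑[ comps (2 ℕ.+ length w) ] λ δ → [ D (x ∷ y ∷ w) ≤ᶜ δ ]· f δ)
    ≡⟨ ∑-comps-suc (length w) _ ⟩
  (∑[ cs ] λ ε → [ D (x ∷ y ∷ w) ≤ᶜ (1 ∷ ε) ]· f (1 ∷ ε) + [ D (x ∷ y ∷ w) ≤ᶜ bump ε ]· f (bump ε))
    ≡⟨ ∑-cong cs (λ ε ε∈ → pointwise ε (∈comps⇒IsComp (1 ℕ.+ length w) ε∈)) ⟩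
  (∑[ cs ] λ ε → [ D (y ∷ w) ≤ᶜ ε ]· f (1 ∷ ε) + [ x ≤?ᵇ y ]· [ D (y ∷ w) ≤ᶜ ε ]· f (bump ε))
    ≡⟨ ∑-+ cs _ _ ⟩
  (∑[ cs ] λ ε → [ D (y ∷ w) ≤ᶜ ε ]· f (1 ∷ ε))
    + (∑[ cs ] λ ε → [ x ≤?ᵇ y ]· [ D (y ∷ w) ≤ᶜ ε ]· f (bump ε))
    ≡⟨ cong₂ _+_ (sym (∑-filter (D (y ∷ w) ≤ᶜ_) cs _))
                 (trans (∑-[]· (x ≤?ᵇ y) cs _)
                        (cong ([ x ≤?ᵇ y ]·_) (sym (∑-filter (D (y ∷ w) ≤ᶜ_) cs _)))) ⟩
  (∑[ refinements (y ∷ w) ] (f ∘ (1 ∷_))) + [ x ≤?ᵇ y ]· (∑[ refinements (y ∷ w) ] (f ∘ bump)) ∎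
  where
  cs = comps (1 ℕ.+ length w)
  pointwise : ∀ ε → IsComp (1 ℕ.+ length w) ε →
    [ D (x ∷ y ∷ w) ≤ᶜ (1 ∷ ε) ]· f (1 ∷ ε) + [ D (x ∷ y ∷ w) ≤ᶜ bump ε ]· f (bump ε)
    ≡ [ D (y ∷ w) ≤ᶜ ε ]· f (1 ∷ ε) + [ x ≤?ᵇ y ]· [ D (y ∷ w) ≤ᶜ ε ]· f (bump ε)
  pointwise ε q = cong₂ _+_
    (cong ([_]· f (1 ∷ ε)) (D≤1∷ x y w q))
    (trans (cong ([_]· f (bump ε)) (D≤bump x y w q)) ([]·-∧ (x ≤?ᵇ y) _ _))

-- Shuffles of words

-- Weakly increasing after a preceding letter `x`; `asc 0` puts no condition on the first letter.
asc : ℕ → List ℕ → Bool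
asc x []      = true
asc x (y ∷ w) = (x ≤?ᵇ y) ∧ asc y w

∑-splits-∷ : ∀ x w (h : List ℕ × List ℕ → ℚ) →
  (∑[ splits (x ∷ w) ] h) ≡ h ([] , x ∷ w) + (∑[ splits w ] λ p → h (x ∷ proj₁ p , proj₂ p))
∑-splits-∷ x w h = trans (∑-∷ _ _ h) (cong (h ([] , x ∷ w) +_) (∑-map _ (splits w) h))

∈splits⇒++ : ∀ w {p} → p ∈ splits w → proj₁ p ++ proj₂ p ≡ w
∈splits⇒++ []      (here refl) = refl
∈splits⇒++ (x ∷ w) (here refl) = refl
∈splits⇒++ (x ∷ w) (there p∈) with ∈-map⁻ _ p∈
... | q , q∈ , refl = cong (x ∷_) (∈splits⇒++ w q∈)

∑-refinements-[] : ∀ (f : List ℕ → ℚ) → (∑[ refinements [] ] f) ≡ f []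
∑-refinements-[] f = ∑-[ [] ] f

∑-refinements-[_] : ∀ x (f : List ℕ → ℚ) → (∑[ refinements (x ∷ []) ] f) ≡ f (1 ∷ [])
∑-refinements-[ x ] f = ∑-[ 1 ∷ [] ] f

-- A refinement of D(w) is a way to cut w into increasing blocks; the sum is
-- organised by the first block.
∑-refinements-∷ : ∀ x w (f : List ℕ → ℚ) →
  (∑[ refinements (x ∷ w) ] f)
  ≡ (∑[ splits w ] λ p → [ asc x (proj₁ p) ]·
       (∑[ refinements (proj₂ p) ] λ δ → f (suc (length (proj₁ p)) ∷ δ)))
∑-refinements-∷ x [] f =
  trans (∑-refinements-[ x ] f) (sym (trans (∑-[ _ ] _) (∑-refinements-[] (f ∘ (1 ∷_)))))
∑-refinements-∷ x (y ∷ w) f = begin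
  (∑[ refinements (x ∷ y ∷ w) ] f)
    ≡⟨ ∑-refinements-∷∷ x y w f ⟩
  (∑[ refinements (y ∷ w) ] (f ∘ (1 ∷_))) + [ x ≤?ᵇ y ]· (∑[ refinements (y ∷ w) ] (f ∘ bump))
    ≡⟨ cong (λ q → (∑[ refinements (y ∷ w) ] (f ∘ (1 ∷_))) + [ x ≤?ᵇ y ]· q) (∑-refinements-∷ y w (f ∘ bump)) ⟩
  (∑[ refinements (y ∷ w) ] (f ∘ (1 ∷_)))
    + [ x ≤?ᵇ y ]· (∑[ splits w ] λ p → [ asc y (proj₁ p) ]·
        (∑[ refinements (proj₂ p) ] λ δ → f (suc (suc (length (proj₁ p))) ∷ δ)))
    ≡⟨ cong ((∑[ refinements (y ∷ w) ] (f ∘ (1 ∷_))) +_)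
         (trans (sym (∑-[]· (x ≤?ᵇ y) (splits w) _))
                (∑-cong′ (splits w) λ p → sym ([]·-∧ (x ≤?ᵇ y) (asc y (proj₁ p)) _))) ⟩
  (∑[ refinements (y ∷ w) ] (f ∘ (1 ∷_)))
    + (∑[ splits w ] λ p → [ asc x (y ∷ proj₁ p) ]·
        (∑[ refinements (proj₂ p) ] λ δ → f (suc (suc (length (proj₁ p))) ∷ δ)))
    ≡⟨ ∑-splits-∷ y w _ ⟨
  (∑[ splits (y ∷ w) ] λ p → [ asc x (proj₁ p) ]·
    (∑[ refinements (proj₂ p) ] λ δ → f (suc (length (proj₁ p)) ∷ δ))) ∎

shuffles : List ℕ → List ℕ → List (List ℕ)
shuffles []      v       = v ∷ []
shuffles (x ∷ u) []      = (x ∷ u) ∷ []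
shuffles (x ∷ u) (y ∷ v) = map (x ∷_) (shuffles u (y ∷ v)) ++ map (y ∷_) (shuffles (x ∷ u) v)

∑-shuffles-[]ˡ : ∀ v (g : List ℕ → ℚ) → (∑[ shuffles [] v ] g) ≡ g v
∑-shuffles-[]ˡ v g = ∑-[ v ] g

∑-shuffles-[]ʳ : ∀ u (g : List ℕ → ℚ) → (∑[ shuffles u [] ] g) ≡ g u
∑-shuffles-[]ʳ []      g = ∑-[ [] ] g
∑-shuffles-[]ʳ (x ∷ u) g = ∑-[ x ∷ u ] g

∑-shuffles-∷∷ : ∀ x u y v (g : List ℕ → ℚ) →
  (∑[ shuffles (x ∷ u) (y ∷ v) ] g)
  ≡ (∑[ shuffles u (y ∷ v) ] λ w → g (x ∷ w)) + (∑[ shuffles (x ∷ u) v ] λ w → g (y ∷ w))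
∑-shuffles-∷∷ x u y v g = trans (∑-++ (map (x ∷_) (shuffles u (y ∷ v))) _ g)
  (cong₂ _+_ (∑-map (x ∷_) (shuffles u (y ∷ v)) g) (∑-map (y ∷_) (shuffles (x ∷ u) v) g))

splitShuffles : List ℕ × List ℕ → List ℕ × List ℕ → (List ℕ → List ℕ → ℚ) → ℚ
splitShuffles p q G =
  ∑[ shuffles (proj₁ p) (proj₁ q) ] λ b → ∑[ shuffles (proj₂ p) (proj₂ q) ] λ w → G b w

-- Shuffling and deconcatenation form a bialgebra: a cut of a shuffle induces cuts of `u` and `v`,
-- and its two halves are arbitrary shuffles of the fronts and of the backs.
∑-shuffles-splits : ∀ u v (G : List ℕ → List ℕ → ℚ) →
  (∑[ shuffles u v ] λ w → ∑[ splits w ] λ p → G (proj₁ p) (proj₂ p))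
  ≡ (∑[ splits u ] λ p → ∑[ splits v ] λ q → splitShuffles p q G)
∑-shuffles-splits [] v G = trans (∑-shuffles-[]ˡ v _) (sym (trans (∑-[ _ ] _)
  (∑-cong′ (splits v) λ q → trans (∑-shuffles-[]ˡ (proj₁ q) _) (∑-shuffles-[]ˡ (proj₂ q) _))))
∑-shuffles-splits u@(_ ∷ _) [] G = trans (∑-shuffles-[]ʳ u _) (∑-cong′ (splits u) λ p → sym
  (trans (∑-[ _ ] _) (trans (∑-shuffles-[]ʳ (proj₁ p) _) (∑-shuffles-[]ʳ (proj₂ p) _))))
∑-shuffles-splits u@(x ∷ u₀) v@(y ∷ v₀) G = begin
  (∑[ shuffles u v ] λ w → ∑[ splits w ] λ p → G (proj₁ p) (proj₂ p))
    ≡⟨ ∑-shuffles-∷∷ x u₀ y v₀ _ ⟩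
  (∑[ shuffles u₀ v ] λ w → ∑[ splits (x ∷ w) ] λ p → G (proj₁ p) (proj₂ p))
    + (∑[ shuffles u v₀ ] λ w → ∑[ splits (y ∷ w) ] λ p → G (proj₁ p) (proj₂ p))
    ≡⟨ cong₂ _+_ (peel x (shuffles u₀ v)) (peel y (shuffles u v₀)) ⟩
  (Hˣ + Lˣ) + (Hʸ + Lʸ)
    ≡⟨ +-interchange Hˣ Lˣ Hʸ Lʸ ⟩
  (Hˣ + Hʸ) + (Lˣ + Lʸ)
    ≡⟨ cong₂ _+_ (sym (∑-shuffles-∷∷ x u₀ y v₀ (G [])))
                 (cong₂ _+_ (∑-shuffles-splits u₀ v (G ∘ (x ∷_))) (∑-shuffles-splits u v₀ (G ∘ (y ∷_)))) ⟩
  R₀ + ((∑[ splits u₀ ] λ p → ∑[ splits v ] λ q → splitShuffles p q (G ∘ (x ∷_)))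
      + (∑[ splits u ] λ p → ∑[ splits v₀ ] λ q → splitShuffles p q (G ∘ (y ∷_))))
    ≡⟨ cong (R₀ +_) (cong₂ _+_ (trans (∑-cong′ (splits u₀) λ p → cutʳ p) (∑-+ (splits u₀) _ _)) cutˡ) ⟩
  R₀ + ((R₂ + R₃) + (R₁ + R₄))
    ≡⟨ cong (R₀ +_) (trans (ℚ.+-comm (R₂ + R₃) (R₁ + R₄)) (rearrange R₁ R₄ R₂ R₃)) ⟩
  R₀ + (R₁ + (R₂ + (R₃ + R₄)))
    ≡⟨ ℚ.+-assoc R₀ R₁ _ ⟨
  (R₀ + R₁) + (R₂ + (R₃ + R₄))
    ≡⟨ cong₂ _+_ (sym first) (trans (cong (R₂ +_) (sym (∑-+ (splits u₀) _ _)))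
                                    (trans (sym (∑-+ (splits u₀) _ _)) (∑-cong′ (splits u₀) λ p → sym (rest p)))) ⟩
  (∑[ splits v ] λ q → splitShuffles ([] , u) q G)
    + (∑[ splits u₀ ] λ p → ∑[ splits v ] λ q → splitShuffles (x ∷ proj₁ p , proj₂ p) q G)
    ≡⟨ ∑-splits-∷ x u₀ _ ⟨
  (∑[ splits u ] λ p → ∑[ splits v ] λ q → splitShuffles p q G) ∎
  where
  -- The right side by fronts: in `R₀` both are empty, in `R₁` only that of `v` is nonempty, in `R₂`
  -- only that of `u`; in `R₃` and `R₄` both are nonempty and their shuffle starts with `x` or `y`
  -- respectively.
  r₁ r₂ : List ℕ × List ℕ → ℚ
  r₁ q = ∑[ shuffles u (proj₂ q) ] G (y ∷ proj₁ q)
  r₂ p = ∑[ shuffles (proj₂ p) v ] G (x ∷ proj₁ p)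
  r₃ r₄ : List ℕ × List ℕ → List ℕ × List ℕ → ℚ
  r₃ p q = splitShuffles p (y ∷ proj₁ q , proj₂ q) (G ∘ (x ∷_))
  r₄ p q = splitShuffles (x ∷ proj₁ p , proj₂ p) q (G ∘ (y ∷_))
  Hˣ Hʸ Lˣ Lʸ R₀ R₁ R₂ R₃ R₄ : ℚ
  Hˣ = ∑[ shuffles u₀ v ] λ w → G [] (x ∷ w)
  Hʸ = ∑[ shuffles u v₀ ] λ w → G [] (y ∷ w)
  Lˣ = ∑[ shuffles u₀ v ] λ w → ∑[ splits w ] λ p → G (x ∷ proj₁ p) (proj₂ p)
  Lʸ = ∑[ shuffles u v₀ ] λ w → ∑[ splits w ] λ p → G (y ∷ proj₁ p) (proj₂ p)
  R₀ = ∑[ shuffles u v ] G []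
  R₁ = ∑[ splits v₀ ] r₁
  R₂ = ∑[ splits u₀ ] r₂
  R₃ = ∑[ splits u₀ ] λ p → ∑[ splits v₀ ] r₃ p
  R₄ = ∑[ splits u₀ ] λ p → ∑[ splits v₀ ] r₄ p

  rearrange : ∀ a b c d → (a + b) + (c + d) ≡ a + (c + (d + b))
  rearrange = solve 4 (λ a b c d → (a :+ b) :+ (c :+ d) := a :+ (c :+ (d :+ b))) refl
     where open +-*-Solver

  peel : ∀ z ws → (∑[ ws ] λ w → ∑[ splits (z ∷ w) ] λ p → G (proj₁ p) (proj₂ p))
    ≡ (∑[ ws ] λ w → G [] (z ∷ w)) + (∑[ ws ] λ w → ∑[ splits w ] λ p → G (z ∷ proj₁ p) (proj₂ p))
  peel z ws = trans (∑-cong′ ws λ w → ∑-splits-∷ z w _) (∑-+ ws _ _)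

  cutʳ : ∀ p → (∑[ splits v ] λ q → splitShuffles p q (G ∘ (x ∷_))) ≡ r₂ p + (∑[ splits v₀ ] r₃ p)
  cutʳ p = trans (∑-splits-∷ y v₀ _)
    (cong (_+ (∑[ splits v₀ ] r₃ p)) (∑-shuffles-[]ʳ (proj₁ p) _))

  cutˡ : (∑[ splits u ] λ p → ∑[ splits v₀ ] λ q → splitShuffles p q (G ∘ (y ∷_))) ≡ R₁ + R₄
  cutˡ = trans (∑-splits-∷ x u₀ _)
    (cong (_+ R₄) (∑-cong′ (splits v₀) λ q → ∑-shuffles-[]ˡ (proj₁ q) _))

  first : (∑[ splits v ] λ q → splitShuffles ([] , u) q G) ≡ R₀ + R₁
  first = trans (∑-splits-∷ y v₀ _)
    (cong₂ _+_ (∑-shuffles-[]ˡ [] _) (∑-cong′ (splits v₀) λ q → ∑-shuffles-[]ˡ (y ∷ proj₁ q) _))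

  rest : ∀ p → (∑[ splits v ] λ q → splitShuffles (x ∷ proj₁ p , proj₂ p) q G)
    ≡ r₂ p + ((∑[ splits v₀ ] r₃ p) + (∑[ splits v₀ ] r₄ p))
  rest p = trans (∑-splits-∷ y v₀ _) (cong₂ _+_ (∑-shuffles-[]ʳ (x ∷ proj₁ p) _)
    (trans (∑-cong′ (splits v₀) λ q → ∑-shuffles-∷∷ x (proj₁ p) y (proj₁ q) _) (∑-+ (splits v₀) _ _)))

≤⇒≤?ᵇ : ∀ {x y} → x ℕ.≤ y → (x ≤?ᵇ y) ≡ true
≤⇒≤?ᵇ {x} {y} x≤y with y <ᵇ x in eq
... | false = refl
... | true  = ⊥-elim (ℕ.≤⇒≯ x≤y (ℕ.<ᵇ⇒< y x (subst T (sym eq) _)))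

<⇒≤?ᵇ-false : ∀ {x y} → x ℕ.< y → (y ≤?ᵇ x) ≡ false
<⇒≤?ᵇ-false {x} {y} x<y with x <ᵇ y in eq
... | true  = refl
... | false = ⊥-elim (subst T eq (ℕ.<⇒<ᵇ x<y))

≤?ᵇ⇒≤ : ∀ {x y} → (x ≤?ᵇ y) ≡ true → x ℕ.≤ y
≤?ᵇ⇒≤ {x} {y} eq with x ℕ.≤? y
... | yes x≤y = x≤y
... | no  x≰y with trans (sym eq) (<⇒≤?ᵇ-false (ℕ.≰⇒> x≰y))
...   | ()

-- Two increasing words on disjoint alphabets have exactly one increasing shuffle.
∑-shuffles-asc : ∀ z b b′ (Q : ℕ → ℚ) → Disjoint b b′ →
  (∑[ shuffles b b′ ] λ w → [ asc z w ]· Q (length w))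
  ≡ [ asc z b ]· [ asc z b′ ]· Q (length b ℕ.+ length b′)
∑-shuffles-asc z [] b′ Q dis = ∑-shuffles-[]ˡ b′ _
∑-shuffles-asc z b@(_ ∷ _) [] Q dis =
  trans (∑-shuffles-[]ʳ b _) (cong (λ k → [ asc z b ]· Q k) (sym (ℕ.+-identityʳ (length b))))
∑-shuffles-asc z (x ∷ b) (y ∷ b′) Q dis = begin
  (∑[ shuffles (x ∷ b) (y ∷ b′) ] λ w → [ asc z w ]· Q (length w))
    ≡⟨ ∑-shuffles-∷∷ x b y b′ _ ⟩
  (∑[ shuffles b (y ∷ b′) ] λ w → [ asc z (x ∷ w) ]· Q (suc (length w)))
    + (∑[ shuffles (x ∷ b) b′ ] λ w → [ asc z (y ∷ w) ]· Q (suc (length w)))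
    ≡⟨ cong₂ _+_ (pull x (shuffles b (y ∷ b′))) (pull y (shuffles (x ∷ b) b′)) ⟩
  [ z ≤?ᵇ x ]· (∑[ shuffles b (y ∷ b′) ] λ w → [ asc x w ]· Q (suc (length w)))
    + [ z ≤?ᵇ y ]· (∑[ shuffles (x ∷ b) b′ ] λ w → [ asc y w ]· Q (suc (length w)))
    ≡⟨ cong₂ (λ p q → [ z ≤?ᵇ x ]· p + [ z ≤?ᵇ y ]· q)
         (∑-shuffles-asc x b (y ∷ b′) (Q ∘ suc) λ (i , j) → dis (there i , j))
         (∑-shuffles-asc y (x ∷ b) b′ (Q ∘ suc) λ (i , j) → dis (i , there j)) ⟩
  [ z ≤?ᵇ x ]· [ asc x b ]· [ (x ≤?ᵇ y) ∧ asc y b′ ]· Q (suc (length b ℕ.+ suc (length b′)))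
    + [ z ≤?ᵇ y ]· [ (y ≤?ᵇ x) ∧ asc x b ]· [ asc y b′ ]· Q (suc (suc (length b) ℕ.+ length b′))
    ≡⟨ cong (λ k → [ z ≤?ᵇ x ]· [ asc x b ]· [ (x ≤?ᵇ y) ∧ asc y b′ ]· Q (suc (length b ℕ.+ suc (length b′)))
                   + [ z ≤?ᵇ y ]· [ (y ≤?ᵇ x) ∧ asc x b ]· [ asc y b′ ]· Q (suc k))
         (sym (ℕ.+-suc (length b) (length b′))) ⟩
  [ z ≤?ᵇ x ]· [ asc x b ]· [ (x ≤?ᵇ y) ∧ asc y b′ ]· q₀ + [ z ≤?ᵇ y ]· [ (y ≤?ᵇ x) ∧ asc x b ]· [ asc y b′ ]· q₀
    ≡⟨ merge ⟩
  [ (z ≤?ᵇ x) ∧ asc x b ]· [ (z ≤?ᵇ y) ∧ asc y b′ ]· q₀ ∎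
  where
  q₀ : ℚ
  q₀ = Q (suc (length b ℕ.+ suc (length b′)))

  pull : ∀ t ws → (∑[ ws ] λ w → [ asc z (t ∷ w) ]· Q (suc (length w)))
    ≡ [ z ≤?ᵇ t ]· (∑[ ws ] λ w → [ asc t w ]· Q (suc (length w)))
  pull t ws = trans (∑-cong′ ws λ w → []·-∧ (z ≤?ᵇ t) (asc t w) _) (∑-[]· (z ≤?ᵇ t) ws _)

  -- The case `x < y`, with `i` and `j` the tests of `z` against `x` and `y`: an increasing shuffle
  -- must start with `x`, and `z ≤ x` already gives `z ≤ y`. `second-below` is the mirror image.
  first-below : ∀ i j m n → (i ≡ true → j ≡ true) →
    [ i ]· [ m ]· [ n ]· q₀ + [ j ]· 0ℚ ≡ [ i ∧ m ]· [ j ∧ n ]· q₀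
  first-below false false m n _ = refl
  first-below false true  m n _ = refl
  first-below true  true  m n _ = ℚ.+-identityʳ _
  first-below true  false m n h with h refl
  ... | ()

  second-below : ∀ i j m n → (j ≡ true → i ≡ true) →
    [ i ]· [ m ]· 0ℚ + [ j ]· [ m ]· [ n ]· q₀ ≡ [ i ∧ m ]· [ j ∧ n ]· q₀
  second-below true  true  true  n _ = ℚ.+-identityˡ _
  second-below true  true  false n _ = refl
  second-below true  false true  n _ = refl
  second-below true  false false n _ = refl
  second-below false false m     n _ = refl
  second-below false true  m n h with h refl
  ... | ()

  merge : [ z ≤?ᵇ x ]· [ asc x b ]· [ (x ≤?ᵇ y) ∧ asc y b′ ]· q₀ + [ z ≤?ᵇ y ]· [ (y ≤?ᵇ x) ∧ asc x b ]· [ asc y b′ ]· q₀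
    ≡ [ (z ≤?ᵇ x) ∧ asc x b ]· [ (z ≤?ᵇ y) ∧ asc y b′ ]· q₀
  merge with ℕ.<-cmp x y
  ... | tri≈ _ x≡y _ = ⊥-elim (dis (here refl , here x≡y))
  ... | tri< x<y _ _ rewrite ≤⇒≤?ᵇ (ℕ.<⇒≤ x<y) | <⇒≤?ᵇ-false x<y =
    first-below (z ≤?ᵇ x) (z ≤?ᵇ y) (asc x b) (asc y b′)
      λ z≤x → ≤⇒≤?ᵇ (ℕ.≤-trans (≤?ᵇ⇒≤ {z} z≤x) (ℕ.<⇒≤ x<y))
  ... | tri> _ _ y<x rewrite ≤⇒≤?ᵇ (ℕ.<⇒≤ y<x) | <⇒≤?ᵇ-false y<x =
    second-below (z ≤?ᵇ x) (z ≤?ᵇ y) (asc x b) (asc y b′)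
      λ z≤y → ≤⇒≤?ᵇ (ℕ.≤-trans (≤?ᵇ⇒≤ {z} z≤y) (ℕ.<⇒≤ y<x))

-- Products of fundamental quasisymmetric functions

-- The value 0 for an empty block lets a sum run over all splits, including the one with empty
-- front, which is the form that `∑-shuffles-splits` handles.
firstBlock : (List ℕ → ℚ) → ℕ → List ℕ → ℚ
firstBlock f zero    w = 0ℚ
firstBlock f (suc k) w = ∑[ refinements w ] λ δ → f (suc k ∷ δ)

∑-refinements-firstBlock : ∀ x w (f : List ℕ → ℚ) →
  (∑[ refinements (x ∷ w) ] f)
  ≡ (∑[ splits (x ∷ w) ] λ p → [ asc 0 (proj₁ p) ]· firstBlock f (length (proj₁ p)) (proj₂ p))
∑-refinements-firstBlock x w f = trans (∑-refinements-∷ x w f)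
  (sym (trans (∑-splits-∷ x w _) (ℚ.+-identityˡ _)))

∑-qsh-∷∷ : ∀ a α b β (f : List ℕ → ℚ) → (∑[ qsh (a ∷ α) (b ∷ β) ] f)
  ≡ (∑[ qsh α (b ∷ β) ] (f ∘ (a ∷_)))
    + ((∑[ qsh (a ∷ α) β ] (f ∘ (b ∷_))) + (∑[ qsh α β ] (f ∘ ((a ℕ.+ b) ∷_))))
∑-qsh-∷∷ a α b β f = trans (∑-++ (map (a ∷_) (qsh α (b ∷ β))) _ f)
  (cong₂ _+_ (∑-map (a ∷_) (qsh α (b ∷ β)) f)
    (trans (∑-++ (map (b ∷_) (qsh (a ∷ α) β)) _ f)
      (cong₂ _+_ (∑-map (b ∷_) (qsh (a ∷ α) β) f) (∑-map ((a ℕ.+ b) ∷_) (qsh α β) f))))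

∑-qsh-[]ʳ : ∀ α (f : List ℕ → ℚ) → (∑[ qsh α [] ] f) ≡ f α
∑-qsh-[]ʳ []      f = ∑-[ [] ] f
∑-qsh-[]ʳ (a ∷ α) f = ∑-[ a ∷ α ] f

Disjoint-splits : ∀ {u v p q} → Disjoint u v → p ∈ splits u → q ∈ splits v →
  Disjoint (proj₁ p) (proj₁ q) × Disjoint (proj₂ p) (proj₂ q)
Disjoint-splits {u} {v} {p} {q} dis p∈ q∈ with ∈splits⇒++ u p∈ | ∈splits⇒++ v q∈
... | refl | refl =
  (λ (i , j) → dis (∈-++⁺ˡ i , ∈-++⁺ˡ j)) ,
  (λ (i , j) → dis (∈-++⁺ʳ (proj₁ p) i , ∈-++⁺ʳ (proj₁ q) j))

length-proj₂-splits : ∀ w {p} → p ∈ splits w → length (proj₂ p) ℕ.≤ length w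
length-proj₂-splits w {p} p∈ with ∈splits⇒++ w p∈
... | refl = ℕ.≤-trans (ℕ.m≤n+m _ (length (proj₁ p))) (ℕ.≤-reflexive (sym (length-++ (proj₁ p))))

-- The functional `f` at the product of F_D(u) and F_D(v).
∑∑-qsh : List ℕ → List ℕ → (List ℕ → ℚ) → ℚ
∑∑-qsh u v f = ∑[ refinements u ] λ α → ∑[ refinements v ] λ β → ∑[ qsh α β ] f

module FirstBlocks (x : ℕ) (u₀ : List ℕ) (y : ℕ) (v₀ : List ℕ) (f : List ℕ → ℚ) where
  private
    u v : List ℕ
    u = x ∷ u₀
    v = y ∷ v₀

  -- The first part of a quasi-shuffle is an increasing first block of `u`, one of `v`, or, in
  -- `fromBoth`, the merger of two. Both sides of the product rule are brought to this three-term
  -- form.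
  fromˡ fromʳ : List ℕ × List ℕ → ℚ
  fromˡ p = [ asc x (proj₁ p) ]· ∑∑-qsh (proj₂ p) v (f ∘ (suc (length (proj₁ p)) ∷_))
  fromʳ q = [ asc y (proj₁ q) ]· ∑∑-qsh u (proj₂ q) (f ∘ (suc (length (proj₁ q)) ∷_))

  fromBoth : List ℕ × List ℕ → List ℕ × List ℕ → ℚ
  fromBoth p q = [ asc x (proj₁ p) ]· [ asc y (proj₁ q) ]· ∑∑-qsh (proj₂ p) (proj₂ q)
    (f ∘ (suc (length (proj₁ p)) ℕ.+ suc (length (proj₁ q)) ∷_))

  expansion : ℚ
  expansion = (∑[ splits u₀ ] fromˡ)
    + ((∑[ splits v₀ ] fromʳ) + (∑[ splits u₀ ] λ p → ∑[ splits v₀ ] fromBoth p))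

  ∑∑-qsh-expand : ∑∑-qsh u v f ≡ expansion
  ∑∑-qsh-expand = begin
    ∑∑-qsh u v f
      ≡⟨ ∑-cong (refinements u) (λ α α∈ → ∑-cong (refinements v) λ β β∈ →
           qsh-parts (∈refinements⇒IsComp u α∈) (∈refinements⇒IsComp v β∈)) ⟩
    (∑[ refinements u ] λ α → ∑[ refinements v ] λ β → qˡ α β + (qʳ α β + qᵇ α β))
      ≡⟨ ∑-cong′ (refinements u) (λ α → trans (∑-+ (refinements v) (qˡ α) _)
           (cong ((∑[ refinements v ] qˡ α) +_) (∑-+ (refinements v) (qʳ α) (qᵇ α)))) ⟩
    (∑[ refinements u ] λ α → (∑[ refinements v ] qˡ α) + ((∑[ refinements v ] qʳ α) + (∑[ refinements v ] qᵇ α)))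
      ≡⟨ trans (∑-+ (refinements u) _ _)
           (cong ((∑[ refinements u ] λ α → ∑[ refinements v ] qˡ α) +_) (∑-+ (refinements u) _ _)) ⟩
    (∑[ refinements u ] λ α → ∑[ refinements v ] qˡ α)
      + ((∑[ refinements u ] λ α → ∑[ refinements v ] qʳ α) + (∑[ refinements u ] λ α → ∑[ refinements v ] qᵇ α))
      ≡⟨ cong₂ _+_ partˡ (cong₂ _+_ partʳ partᵇ) ⟩
    expansion ∎
    where
    -- The three branches of `qsh` made total. The zeros at `[]` are never reached, since
    -- refinements of a nonempty word are nonempty.
    qˡ qʳ qᵇ : List ℕ → List ℕ → ℚ
    qˡ []      β = 0ℚ
    qˡ (a ∷ α) β = ∑[ qsh α β ] (f ∘ (a ∷_))
    qʳ α []      = 0ℚ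
    qʳ α (b ∷ β) = ∑[ qsh α β ] (f ∘ (b ∷_))
    qᵇ []      β       = 0ℚ
    qᵇ (a ∷ α) []      = 0ℚ
    qᵇ (a ∷ α) (b ∷ β) = ∑[ qsh α β ] (f ∘ ((a ℕ.+ b) ∷_))

    qsh-parts : ∀ {n m α β} → IsComp (suc n) α → IsComp (suc m) β →
      (∑[ qsh α β ] f) ≡ qˡ α β + (qʳ α β + qᵇ α β)
    qsh-parts (_∷_ a {α = α} _) (_∷_ b {α = β} _) = ∑-qsh-∷∷ (suc a) α (suc b) β f

    partˡ : (∑[ refinements u ] λ α → ∑[ refinements v ] qˡ α) ≡ (∑[ splits u₀ ] fromˡ)
    partˡ = ∑-refinements-∷ x u₀ _

    partʳ : (∑[ refinements u ] λ α → ∑[ refinements v ] qʳ α) ≡ (∑[ splits v₀ ] fromʳ)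
    partʳ = trans (∑-swap (refinements u) (refinements v) qʳ)
      (trans (∑-refinements-∷ y v₀ _) (∑-cong′ (splits v₀) λ q →
        cong ([ asc y (proj₁ q) ]·_) (∑-swap (refinements (proj₂ q)) (refinements u) _)))

    partᵇ : (∑[ refinements u ] λ α → ∑[ refinements v ] qᵇ α) ≡ (∑[ splits u₀ ] λ p → ∑[ splits v₀ ] fromBoth p)
    partᵇ = trans (∑-refinements-∷ x u₀ _) (∑-cong′ (splits u₀) λ p →
      trans (cong ([ asc x (proj₁ p) ]·_)
              (trans (∑-cong′ (refinements (proj₂ p)) λ α → ∑-refinements-∷ y v₀ _)
                (trans (∑-swap (refinements (proj₂ p)) (splits v₀) _)
                  (∑-cong′ (splits v₀) λ q → ∑-[]· (asc y (proj₁ q)) (refinements (proj₂ p)) _))))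
            (sym (∑-[]· (asc x (proj₁ p)) (splits v₀) _)))

  -- Here a front may be empty: an empty front of `u` yields the terms of `fromʳ`, one of `v` those
  -- of `fromˡ`, and two empty fronts contribute 0 by `firstBlock`.
  blocks : List ℕ × List ℕ → List ℕ × List ℕ → ℚ
  blocks p q = [ asc 0 (proj₁ p) ]· [ asc 0 (proj₁ q) ]·
    (∑[ shuffles (proj₂ p) (proj₂ q) ] firstBlock f (length (proj₁ p) ℕ.+ length (proj₁ q)))

  -- Cutting an increasing first block off a shuffle cuts fronts off `u` and `v`. By
  -- `∑-shuffles-asc` these fronts must be increasing and have a single increasing shuffle, so only
  -- their lengths survive.
  ∑-shuffles-blocks : Disjoint u v →
    (∑[ shuffles u v ] λ w → ∑[ refinements w ] f) ≡ (∑[ splits u ] λ p → ∑[ splits v ] blocks p)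
  ∑-shuffles-blocks dis = begin
    (∑[ shuffles u v ] λ w → ∑[ refinements w ] f)
      -- The expansion by first blocks needs a visible first letter, so the heads are exposed here
      -- and put back two steps later.
      ≡⟨ ∑-shuffles-∷∷ x u₀ y v₀ _ ⟩
    (∑[ shuffles u₀ v ] λ w → ∑[ refinements (x ∷ w) ] f) + (∑[ shuffles u v₀ ] λ w → ∑[ refinements (y ∷ w) ] f)
      ≡⟨ cong₂ _+_ (∑-cong′ (shuffles u₀ v) λ w → ∑-refinements-firstBlock x w f)
                   (∑-cong′ (shuffles u v₀) λ w → ∑-refinements-firstBlock y w f) ⟩
    (∑[ shuffles u₀ v ] λ w → ∑[ splits (x ∷ w) ] λ p → G (proj₁ p) (proj₂ p))
      + (∑[ shuffles u v₀ ] λ w → ∑[ splits (y ∷ w) ] λ p → G (proj₁ p) (proj₂ p))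
      ≡⟨ ∑-shuffles-∷∷ x u₀ y v₀ _ ⟨
    (∑[ shuffles u v ] λ w → ∑[ splits w ] λ p → G (proj₁ p) (proj₂ p))
      ≡⟨ ∑-shuffles-splits u v G ⟩
    (∑[ splits u ] λ p → ∑[ splits v ] λ q → splitShuffles p q G)
      ≡⟨ ∑-cong (splits u) (λ p p∈ → ∑-cong (splits v) λ q q∈ → inner p q (proj₁ (Disjoint-splits dis p∈ q∈))) ⟩
    (∑[ splits u ] λ p → ∑[ splits v ] blocks p) ∎
    where
    G : List ℕ → List ℕ → ℚ
    G b w = [ asc 0 b ]· firstBlock f (length b) w

    inner : ∀ p q → Disjoint (proj₁ p) (proj₁ q) → splitShuffles p q G ≡ blocks p q
    inner p q dis′ = trans
      (∑-cong′ (shuffles (proj₁ p) (proj₁ q)) λ b → ∑-[]· (asc 0 b) (shuffles (proj₂ p) (proj₂ q)) _)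
      (∑-shuffles-asc 0 (proj₁ p) (proj₁ q) (λ k → ∑[ shuffles (proj₂ p) (proj₂ q) ] firstBlock f k) dis′)

  -- The product rule for shorter words is a premise here. It can be supplied because every
  -- surviving term removes a nonempty front from at least one word.
  ∑-blocks-expand :
    (∀ p q f′ → p ∈ splits u → q ∈ splits v →
      length (proj₂ p) ℕ.+ length (proj₂ q) ℕ.< length u ℕ.+ length v →
      ∑∑-qsh (proj₂ p) (proj₂ q) f′ ≡ (∑[ shuffles (proj₂ p) (proj₂ q) ] λ w → ∑[ refinements w ] f′)) →
    (∑[ splits u ] λ p → ∑[ splits v ] blocks p) ≡ expansion
  ∑-blocks-expand ih = begin
    (∑[ splits u ] λ p → ∑[ splits v ] blocks p)
      ≡⟨ ∑-splits-∷ x u₀ _ ⟩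
    (∑[ splits v ] blocks ([] , u)) + (∑[ splits u₀ ] λ p → ∑[ splits v ] blocks (x ∷ proj₁ p , proj₂ p))
      ≡⟨ cong₂ _+_ atʳ (trans (∑-cong (splits u₀) atˡ) (∑-+ (splits u₀) fromˡ _)) ⟩
    (∑[ splits v₀ ] fromʳ) + ((∑[ splits u₀ ] fromˡ) + (∑[ splits u₀ ] λ p → ∑[ splits v₀ ] fromBoth p))
      ≡⟨ rotate (∑[ splits v₀ ] fromʳ) (∑[ splits u₀ ] fromˡ) _ ⟩
    expansion ∎
    where
    rotate : ∀ a b c → a + (b + c) ≡ b + (a + c)
    rotate a b c = trans (sym (ℚ.+-assoc a b c)) (trans (cong (_+ c) (ℚ.+-comm a b)) (ℚ.+-assoc b a c))

    atʳ : (∑[ splits v ] blocks ([] , u)) ≡ (∑[ splits v₀ ] fromʳ)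
    atʳ = trans (∑-splits-∷ y v₀ _) (trans (cong₂ _+_ (∑-0 (shuffles u v))
        (∑-cong (splits v₀) λ q q∈ → cong ([ asc y (proj₁ q) ]·_)
          (sym (ih ([] , u) (y ∷ proj₁ q , proj₂ q) _ (here refl) (there (∈-map⁺ _ q∈))
            (ℕ.+-monoʳ-< (length u) (s≤s (length-proj₂-splits v₀ q∈)))))))
      (ℚ.+-identityˡ _))

    atˡ : ∀ p → p ∈ splits u₀ → (∑[ splits v ] blocks (x ∷ proj₁ p , proj₂ p)) ≡ fromˡ p + (∑[ splits v₀ ] fromBoth p)
    atˡ p p∈ = trans (∑-splits-∷ y v₀ _) (cong₂ _+_
        (cong ([ asc x (proj₁ p) ]·_) (trans
          (cong (λ k → ∑[ shuffles (proj₂ p) v ] firstBlock f (suc k)) (ℕ.+-identityʳ (length (proj₁ p))))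
          (sym (ih (x ∷ proj₁ p , proj₂ p) ([] , v) _ (there (∈-map⁺ _ p∈)) (here refl)
            (ℕ.+-monoˡ-< (length v) (s≤s (length-proj₂-splits u₀ p∈)))))))
        (∑-cong (splits v₀) λ q q∈ → cong (λ r → [ asc x (proj₁ p) ]· [ asc y (proj₁ q) ]· r)
          (sym (ih (x ∷ proj₁ p , proj₂ p) (y ∷ proj₁ q , proj₂ q) _ (there (∈-map⁺ _ p∈)) (there (∈-map⁺ _ q∈))
            (ℕ.+-mono-< (s≤s (length-proj₂-splits u₀ p∈)) (s≤s (length-proj₂-splits v₀ q∈)))))))

-- F_u F_v = Σ F_w over the shuffles w of u and v.
∑-qsh≡∑-shuffles : ∀ u v (f : List ℕ → ℚ) → Disjoint u v →
  ∑∑-qsh u v f ≡ (∑[ shuffles u v ] λ w → ∑[ refinements w ] f)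
∑-qsh≡∑-shuffles u v f = go _ u v f ℕ.≤-refl
  where
  -- The recursive calls are on backs of splits, which are not structural subterms; `n` bounds the
  -- total length.
  go : ∀ n u v f → length u ℕ.+ length v ℕ.≤ n → Disjoint u v →
    ∑∑-qsh u v f ≡ (∑[ shuffles u v ] λ w → ∑[ refinements w ] f)
  go n [] v f _ dis = trans (∑-refinements-[] _)
    (trans (∑-cong′ (refinements v) λ β → ∑-[ β ] f) (sym (∑-shuffles-[]ˡ v _)))
  go n u@(_ ∷ _) [] f _ dis = trans (∑-cong′ (refinements u) λ α → trans (∑-refinements-[] _) (∑-qsh-[]ʳ α f))
    (sym (∑-shuffles-[]ʳ u _))
  go (suc n) (x ∷ u₀) (y ∷ v₀) f (s≤s l) dis = trans ∑∑-qsh-expand (sym (trans (∑-shuffles-blocks dis)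
    (∑-blocks-expand λ p q f′ p∈ q∈ shorter →
      go n (proj₂ p) (proj₂ q) f′ (ℕ.≤-pred (ℕ.≤-trans shorter (s≤s l))) (proj₂ (Disjoint-splits dis p∈ q∈)))))
    where open FirstBlocks x u₀ y v₀ f

-- Hopf endomorphisms

∈shuffles⇒length : ∀ u v {w} → w ∈ shuffles u v → length w ≡ length u ℕ.+ length v
∈shuffles⇒length []      v       (here refl) = refl
∈shuffles⇒length (x ∷ u) []      (here refl) = cong suc (sym (ℕ.+-identityʳ (length u)))
∈shuffles⇒length (x ∷ u) (y ∷ v) w∈ with ∈-++⁻ (map (x ∷_) (shuffles u (y ∷ v))) w∈
... | inj₁ w∈ˡ with ∈-map⁻ (x ∷_) w∈ˡ
...   | w′ , w′∈ , refl = cong suc (∈shuffles⇒length u (y ∷ v) w′∈)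
∈shuffles⇒length (x ∷ u) (y ∷ v) w∈ | inj₂ w∈ʳ with ∈-map⁻ (y ∷_) w∈ʳ
...   | w′ , w′∈ , refl = cong suc (trans (∈shuffles⇒length (x ∷ u) v w′∈) (sym (ℕ.+-suc (length u) (length v))))

IsComp-++ : ∀ {m n α β} → IsComp m α → IsComp n β → IsComp (m ℕ.+ n) (α ++ β)
IsComp-++ []              q = q
IsComp-++ {α = α} {β} (_∷_ a {m} p) q = subst (λ k → IsComp k (α ++ β)) (sym (ℕ.+-assoc (suc a) m _)) (a ∷ IsComp-++ p q)

IsComp-++⁻ : ∀ {n} α {β} → IsComp n (α ++ β) → IsComp (size α) α × IsComp (size β) β
IsComp-++⁻ []      p       = [] , subst (λ k → IsComp k _) (sym (IsComp-size p)) p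
IsComp-++⁻ (_ ∷ α) (a ∷ p) with IsComp-++⁻ α p
... | pα , pβ = a ∷ pα , pβ

≡ᵇ-refl : ∀ n → (n ≡ᵇ n) ≡ true
≡ᵇ-refl zero    = refl
≡ᵇ-refl (suc n) = ≡ᵇ-refl n

≢⇒≡ᵇ-false : ∀ {m n} → m ≢ n → (m ≡ᵇ n) ≡ false
≢⇒≡ᵇ-false {m} {n} m≢n with m ≡ᵇ n in eq
... | false = refl
... | true  = ⊥-elim (m≢n (ℕ.≡ᵇ⇒≡ m n (subst T (sym eq) tt)))

∑-splits-size0 : ∀ {n γ} (g : List ℕ → List ℕ → ℚ) → IsComp n γ →
  (∑[ splits γ ] λ p → [ size (proj₁ p) ≡ᵇ 0 ]· g (proj₁ p) (proj₂ p)) ≡ g [] γ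
∑-splits-size0 g []                    = ∑-[ _ ] _
∑-splits-size0 g (_∷_ a {α = γ} p) = trans (∑-splits-∷ (suc a) γ _)
  (trans (cong (g [] (suc a ∷ γ) +_) (∑-0 (splits γ))) (ℚ.+-identityʳ _))

-- The first part of `bump γ` is at least 2, so no front has size 1.
∑-splits-bump-size1 : ∀ {n γ} (g : List ℕ → List ℕ → ℚ) → IsComp (suc n) γ →
  (∑[ splits (bump γ) ] λ p → [ size (proj₁ p) ≡ᵇ 1 ]· g (proj₁ p) (proj₂ p)) ≡ 0ℚ
∑-splits-bump-size1 g (_∷_ a {α = γ} p) = trans (∑-splits-∷ (suc (suc a)) γ _)
  (trans (ℚ.+-identityˡ _) (∑-0 (splits γ)))

∑-splits-bump : ∀ {n γ} m (g : List ℕ → List ℕ → ℚ) → IsComp (suc n) γ →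
  (∑[ splits (bump γ) ] λ p → [ size (proj₁ p) ≡ᵇ suc (suc m) ]· g (proj₁ p) (proj₂ p))
  ≡ (∑[ splits γ ] λ p → [ size (proj₁ p) ≡ᵇ suc m ]· g (bump (proj₁ p)) (proj₂ p))
∑-splits-bump m g (_∷_ a {α = γ} p) =
  trans (∑-splits-∷ (suc (suc a)) γ _) (sym (∑-splits-∷ (suc a) γ _))

-- Refinements of D(uv) with a cut after u are pairs of refinements of D(u) and
-- D(v), whether or not uv has a descent there.
∑-refinements-++ : ∀ u v (g : List ℕ → List ℕ → ℚ) →
  (∑[ refinements (u ++ v) ] λ γ → ∑[ splits γ ] λ p →
    [ size (proj₁ p) ≡ᵇ length u ]· g (proj₁ p) (proj₂ p))
  ≡ (∑[ refinements u ] λ α → ∑[ refinements v ] g α)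
∑-refinements-++ [] v g = trans
  (∑-cong (refinements v) λ γ γ∈ → ∑-splits-size0 g (∈refinements⇒IsComp v γ∈))
  (sym (∑-refinements-[] _))
∑-refinements-++ (x ∷ []) [] g = begin
  _ ≡⟨ ∑-refinements-[ x ] _ ⟩
  _ ≡⟨ ∑-splits-∷ 1 [] _ ⟩
  _ ≡⟨ ℚ.+-identityˡ _ ⟩
  _ ≡⟨ ∑-[ _ ] _ ⟩
  g (1 ∷ []) [] ≡⟨ trans (∑-refinements-[ x ] _) (∑-refinements-[] _) ⟨
  (∑[ refinements (x ∷ []) ] λ α → ∑[ refinements [] ] g α) ∎
∑-refinements-++ (x ∷ []) v@(y ∷ v₀) g = begin
  _ ≡⟨ ∑-refinements-∷∷ x y v₀ _ ⟩
  _ ≡⟨ cong₂ _+_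
         (∑-cong (refinements v) λ γ γ∈ → trans (∑-splits-∷ 1 γ _)
           (trans (ℚ.+-identityˡ _) (∑-splits-size0 (g ∘ (1 ∷_)) (∈refinements⇒IsComp v γ∈))))
         (trans (cong ([ x ≤?ᵇ y ]·_) (∑-≡0 (refinements v) λ γ γ∈ →
                  ∑-splits-bump-size1 g (∈refinements⇒IsComp v γ∈)))
                ([]·-0 (x ≤?ᵇ y))) ⟩
  _ ≡⟨ ℚ.+-identityʳ _ ⟩
  (∑[ refinements v ] g (1 ∷ [])) ≡⟨ ∑-refinements-[ x ] _ ⟨
  (∑[ refinements (x ∷ []) ] λ α → ∑[ refinements v ] g α) ∎
∑-refinements-++ (x ∷ y ∷ u) v g = begin
  _ ≡⟨ ∑-refinements-∷∷ x y (u ++ v) _ ⟩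
  _ ≡⟨ cong₂ (λ p q → p + [ x ≤?ᵇ y ]· q)
         (∑-cong′ (refinements (y ∷ u ++ v)) λ γ → trans (∑-splits-∷ 1 γ _) (ℚ.+-identityˡ _))
         (∑-cong (refinements (y ∷ u ++ v)) λ γ γ∈ →
           ∑-splits-bump (length u) g (∈refinements⇒IsComp (y ∷ u ++ v) γ∈)) ⟩
  _ ≡⟨ cong₂ (λ p q → p + [ x ≤?ᵇ y ]· q)
         (∑-refinements-++ (y ∷ u) v (g ∘ (1 ∷_))) (∑-refinements-++ (y ∷ u) v (g ∘ bump)) ⟩
  _ ≡⟨ ∑-refinements-∷∷ x y u _ ⟨
  (∑[ refinements (x ∷ y ∷ u) ] λ α → ∑[ refinements v ] g α) ∎

∑∑-comps-δ : ∀ {a b α β} (f g : List ℕ → ℚ) → IsComp a α → IsComp b β →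
  (∑[ comps a ] λ α′ → ∑[ comps b ] λ β′ → f α′ * (g β′ * (δᶜ α′ α * δᶜ β′ β))) ≡ f α * g β
∑∑-comps-δ {a} {b} {α} {β} f g p q = begin
  (∑[ comps a ] λ α′ → ∑[ comps b ] λ β′ → f α′ * (g β′ * (δᶜ α′ α * δᶜ β′ β)))
    ≡⟨ ∑-cong′ (comps a) (λ α′ → ∑-cong′ (comps b) λ β′ → regroup (f α′) (g β′) (δᶜ α′ α) (δᶜ β′ β)) ⟩
  (∑[ comps a ] λ α′ → ∑[ comps b ] λ β′ → (f α′ * δᶜ α′ α) * (g β′ * δᶜ β′ β))
    ≡⟨ ∑-product (comps a) (comps b) (λ α′ → f α′ * δᶜ α′ α) (λ β′ → g β′ * δᶜ β′ β) ⟩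
  (∑[ comps a ] λ α′ → f α′ * δᶜ α′ α) * (∑[ comps b ] λ β′ → g β′ * δᶜ β′ β)
    ≡⟨ cong₂ _*_ (∑-comps-δ f p) (∑-comps-δ g q) ⟩
  f α * g β ∎
  where
  regroup : ∀ r s t u → r * (s * (t * u)) ≡ (r * t) * (s * u)
  regroup = solve 4 (λ r s t u → r :* (s :* (t :* u)) := (r :* t) :* (s :* u)) refl
     where open +-*-Solver

∑-qsh-∷ʳ-≡0 : ∀ α b β (g : List ℕ → ℚ) → (∀ c γ → g (c ∷ γ) ≡ 0ℚ) → (∑[ qsh α (b ∷ β) ] g) ≡ 0ℚ
∑-qsh-∷ʳ-≡0 []      b β g g≡0 = trans (∑-[ _ ] g) (g≡0 b β)
∑-qsh-∷ʳ-≡0 (a ∷ α) b β g g≡0 = trans (∑-qsh-∷∷ a α b β g)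
  (cong₂ _+_ (∑-≡0 (qsh α (b ∷ β)) λ γ _ → g≡0 a γ)
    (cong₂ _+_ (∑-≡0 (qsh (a ∷ α) β) λ γ _ → g≡0 b γ) (∑-≡0 (qsh α β) λ γ _ → g≡0 (a ℕ.+ b) γ)))

∑-qsh-∷ˡ-≡0 : ∀ a α β (g : List ℕ → ℚ) → (∀ c γ → g (c ∷ γ) ≡ 0ℚ) → (∑[ qsh (a ∷ α) β ] g) ≡ 0ℚ
∑-qsh-∷ˡ-≡0 a α []      g g≡0 = trans (∑-[ _ ] g) (g≡0 a α)
∑-qsh-∷ˡ-≡0 a α (b ∷ β) g g≡0 = ∑-qsh-∷ʳ-≡0 (a ∷ α) b β g g≡0

-- In degree n the coefficient of M_(n) is the value at x₁ = 1 and all other variables 0, hence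
-- multiplicative. Combinatorially, a quasi-shuffle of nonempty compositions has one part only if
-- two one-part compositions are merged.
∑-qsh-δ-top : ∀ {a b α β} → IsComp a α → IsComp b β →
  (∑[ qsh α β ] λ γ → δᶜ γ (top (a ℕ.+ b))) ≡ δᶜ α (top a) * δᶜ β (top b)
∑-qsh-δ-top {b = b} {β = β} [] q = trans (∑-[ _ ] _) (sym (ℚ.*-identityˡ (δᶜ β (top b))))
∑-qsh-δ-top {α = α} (_∷_ a {m} p) [] = trans (∑-[ _ ] _) (trans
  (cong (λ k → δᶜ α (top k)) (ℕ.+-identityʳ (suc a ℕ.+ m))) (sym (ℚ.*-identityʳ _)))
∑-qsh-δ-top (_∷_ a {m} {α} p) (_∷_ b {n} {β} q) = begin
  (∑[ qsh (suc a ∷ α) (suc b ∷ β) ] λ γ → δᶜ γ t)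
    ≡⟨ ∑-qsh-∷∷ (suc a) α (suc b) β _ ⟩
  (∑[ qsh α (suc b ∷ β) ] λ γ → δᶜ (suc a ∷ γ) t)
    + ((∑[ qsh (suc a ∷ α) β ] λ γ → δᶜ (suc b ∷ γ) t) + (∑[ qsh α β ] λ γ → δᶜ (suc a ℕ.+ suc b ∷ γ) t))
    ≡⟨ cong₂ (λ r s → r + (s + (∑[ qsh α β ] λ γ → δᶜ (suc a ℕ.+ suc b ∷ γ) t)))
         (∑-qsh-∷ʳ-≡0 α (suc b) β _ λ c γ → long (suc a) c γ _)
         (∑-qsh-∷ˡ-≡0 (suc a) α β _ λ c γ → long (suc b) c γ _) ⟩
  0ℚ + (0ℚ + (∑[ qsh α β ] λ γ → δᶜ (suc a ℕ.+ suc b ∷ γ) t))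
    ≡⟨ trans (ℚ.+-identityˡ _) (ℚ.+-identityˡ _) ⟩
  (∑[ qsh α β ] λ γ → δᶜ (suc a ℕ.+ suc b ∷ γ) t)
    ≡⟨ merged p q ⟩
  δᶜ (suc a ∷ α) (top (suc a ℕ.+ m)) * δᶜ (suc b ∷ β) (top (suc b ℕ.+ n)) ∎
  where
  t : List ℕ
  t = top ((suc a ℕ.+ m) ℕ.+ (suc b ℕ.+ n))

  long : ∀ x c γ k → δᶜ (x ∷ c ∷ γ) (k ∷ []) ≡ 0ℚ
  long x c γ k = δᶜ-≢ {x ∷ c ∷ γ} {k ∷ []} λ ()

  merged : ∀ {m n α β} → IsComp m α → IsComp n β →
    (∑[ qsh α β ] λ γ → δᶜ (suc a ℕ.+ suc b ∷ γ) (top ((suc a ℕ.+ m) ℕ.+ (suc b ℕ.+ n))))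
    ≡ δᶜ (suc a ∷ α) (top (suc a ℕ.+ m)) * δᶜ (suc b ∷ β) (top (suc b ℕ.+ n))
  merged [] [] rewrite ℕ.+-identityʳ a | ℕ.+-identityʳ b = trans (∑-[ _ ] _)
    (trans (δᶜ-refl (suc a ℕ.+ suc b ∷ [])) (sym (cong₂ _*_ (δᶜ-refl (suc a ∷ [])) (δᶜ-refl (suc b ∷ [])))))
  merged {n = n} {β = β} (_∷_ c {m′} {α} p) q = trans
    (∑-qsh-∷ˡ-≡0 (suc c) α β _ λ d γ → long (suc a ℕ.+ suc b) d γ _)
    (sym (trans (cong (_* δᶜ (suc b ∷ β) (top (suc b ℕ.+ n)))
      (long (suc a) (suc c) α (suc a ℕ.+ (suc c ℕ.+ m′))))
      (ℚ.*-zeroˡ (δᶜ (suc b ∷ β) (top (suc b ℕ.+ n))))))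
  merged {m} {α = α} [] (_∷_ c {α = β} q) = trans
    (∑-qsh-∷ʳ-≡0 [] (suc c) β _ λ d γ → long (suc a ℕ.+ suc b) d γ _)
    (sym (trans (cong (δᶜ (suc a ∷ []) (top (suc a ℕ.+ 0)) *_) (long (suc b) (suc c) β _))
      (ℚ.*-zeroʳ (δᶜ (suc a ∷ []) (top (suc a ℕ.+ 0))))))

-- Consequences of the product and coproduct axioms

module HopfEnd {Φ : List ℕ → List ℕ → ℚ} (Φ-hopf : IsHopfEnd Φ) where
  open IsHopfEnd Φ-hopf

  ∑-qsh-Φ-top : ∀ {a b α β} → IsComp a α → IsComp b β →
    (∑[ qsh α β ] λ γ → Φ γ (top (a ℕ.+ b))) ≡ Φ α (top a) * Φ β (top b)
  ∑-qsh-Φ-top {a} {b} {α} {β} p q = begin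
    (∑[ qsh α β ] λ γ → Φ γ (top (a ℕ.+ b)))
      ≡⟨ ∑≡Σ _ _ ⟩
    (Σ[ qsh α β ] λ γ → Φ γ (top (a ℕ.+ b)))
      ≡⟨ mult a b α β (top (a ℕ.+ b)) (IsComp⇒∈comps p) (IsComp⇒∈comps q) (IsComp⇒∈comps (IsComp-top (a ℕ.+ b))) ⟩
    (Σ[ comps a ] λ α′ → Σ[ comps b ] λ β′ → Φ α α′ * (Φ β β′ * (Σ[ qsh α′ β′ ] λ γ → δᶜ γ (top (a ℕ.+ b)))))
      ≡⟨ ∑≡Σ (comps a) _ ⟨
    (∑[ comps a ] λ α′ → Σ[ comps b ] λ β′ → Φ α α′ * (Φ β β′ * (Σ[ qsh α′ β′ ] λ γ → δᶜ γ (top (a ℕ.+ b)))))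
      ≡⟨ ∑-cong (comps a) (λ α′ α′∈ → trans (sym (∑≡Σ (comps b) _)) (∑-cong (comps b) λ β′ β′∈ →
           cong (λ r → Φ α α′ * (Φ β β′ * r)) (trans (sym (∑≡Σ (qsh α′ β′) _))
             (∑-qsh-δ-top (∈comps⇒IsComp a α′∈) (∈comps⇒IsComp b β′∈))))) ⟩
    (∑[ comps a ] λ α′ → ∑[ comps b ] λ β′ → Φ α α′ * (Φ β β′ * (δᶜ α′ (top a) * δᶜ β′ (top b))))
      ≡⟨ ∑∑-comps-δ (Φ α) (Φ β) (IsComp-top a) (IsComp-top b) ⟩
    Φ α (top a) * Φ β (top b) ∎

  -- The coproduct axiom with its deltas summed out. As Φ preserves degree, a split of `γ`
  -- contributes only if its front has the size of `α`.
  Φ-++ : ∀ {a b α β γ} → IsComp a α → IsComp b β → IsComp (a ℕ.+ b) γ →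
    Φ γ (α ++ β) ≡ (∑[ splits γ ] λ p → [ size (proj₁ p) ≡ᵇ a ]· (Φ (proj₁ p) α * Φ (proj₂ p) β))
  Φ-++ {a} {b} {α} {β} {γ} pα pβ pγ = begin
    Φ γ (α ++ β)
      ≡⟨ ∑-comps-δ (Φ γ) (IsComp-++ pα pβ) ⟨
    (∑[ comps (a ℕ.+ b) ] λ ε → Φ γ ε * δᶜ ε (α ++ β))
      ≡⟨ ∑≡Σ (comps (a ℕ.+ b)) _ ⟩
    (Σ[ comps (a ℕ.+ b) ] λ ε → Φ γ ε * δᶜ ε (α ++ β))
      ≡⟨ comult a b α β γ (IsComp⇒∈comps pα) (IsComp⇒∈comps pβ) (IsComp⇒∈comps pγ) ⟩
    (Σ[ splits γ ] λ p → Σ[ comps (size (proj₁ p)) ] λ α′ → Σ[ comps (size (proj₂ p)) ] λ β′ →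
      Φ (proj₁ p) α′ * (Φ (proj₂ p) β′ * (δᶜ α′ α * δᶜ β′ β)))
      ≡⟨ ∑≡Σ (splits γ) _ ⟨
    (∑[ splits γ ] λ p → Σ[ comps (size (proj₁ p)) ] λ α′ → Σ[ comps (size (proj₂ p)) ] λ β′ →
      Φ (proj₁ p) α′ * (Φ (proj₂ p) β′ * (δᶜ α′ α * δᶜ β′ β)))
      ≡⟨ ∑-cong (splits γ) (λ p p∈ → trans (sym (∑≡Σ (comps (size (proj₁ p))) _)) (trans
           (∑-cong′ (comps (size (proj₁ p))) λ α′ → sym (∑≡Σ (comps (size (proj₂ p))) _)) (at-split p p∈))) ⟩
    (∑[ splits γ ] λ p → [ size (proj₁ p) ≡ᵇ a ]· (Φ (proj₁ p) α * Φ (proj₂ p) β)) ∎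
    where
    at-split : ∀ p → p ∈ splits γ →
      (∑[ comps (size (proj₁ p)) ] λ α′ → ∑[ comps (size (proj₂ p)) ] λ β′ →
        Φ (proj₁ p) α′ * (Φ (proj₂ p) β′ * (δᶜ α′ α * δᶜ β′ β)))
      ≡ [ size (proj₁ p) ≡ᵇ a ]· (Φ (proj₁ p) α * Φ (proj₂ p) β)
    at-split p@(γ₁ , γ₂) p∈ with size γ₁ ℕ.≟ a
    ... | yes s₁≡a = trans
      (∑∑-comps-δ (Φ γ₁) (Φ γ₂) (subst (λ k → IsComp k α) (sym s₁≡a) pα) (subst (λ k → IsComp k β) (sym s₂≡b) pβ))
      (cong ([_]· (Φ γ₁ α * Φ γ₂ β)) (sym (trans (cong (_≡ᵇ a) s₁≡a) (≡ᵇ-refl a))))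
      where
      s₂≡b : size γ₂ ≡ b
      s₂≡b = ℕ.+-cancelˡ-≡ a (size γ₂) b (trans (cong (ℕ._+ size γ₂) (sym s₁≡a))
        (trans (sym (sum-++ γ₁ γ₂)) (trans (cong size (∈splits⇒++ γ p∈)) (IsComp-size pγ))))
    ... | no  s₁≢a = trans
      (∑-≡0 (comps (size γ₁)) λ α′ α′∈ → ∑-≡0 (comps (size γ₂)) λ β′ _ →
        vanish (Φ γ₁ α′) (Φ γ₂ β′) (δᶜ β′ β) (δᶜ-≢ {α′} {α} λ { refl →
          s₁≢a (trans (sym (IsComp-size (∈comps⇒IsComp (size γ₁) α′∈))) (IsComp-size pα)) }))
      (cong ([_]· (Φ γ₁ α * Φ γ₂ β)) (sym (≢⇒≡ᵇ-false s₁≢a)))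
      where
      vanish : ∀ r s t {d} → d ≡ 0ℚ → r * (s * (d * t)) ≡ 0ℚ
      vanish r s t refl = trans (cong (λ q → r * (s * q)) (ℚ.*-zeroˡ t))
        (trans (cong (r *_) (ℚ.*-zeroʳ s)) (ℚ.*-zeroʳ r))

  -- The coefficient of M_β in Φ(F_D(w)).
  Ψ : List ℕ → List ℕ → ℚ
  Ψ w β = ∑[ refinements w ] λ δ → Φ δ β

  ψ : List ℕ → ℚ
  ψ w = Ψ w (top (length w))

  -- By `Φ-++` only refinements with a cut after `u` contribute, and these are pairs of refinements
  -- for `u` and for `v`.
  Ψ-++ : ∀ u v {α β} → IsComp (length u) α → IsComp (length v) β → Ψ (u ++ v) (α ++ β) ≡ Ψ u α * Ψ v β
  Ψ-++ u v {α} {β} pα pβ = begin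
    Ψ (u ++ v) (α ++ β)
      ≡⟨ ∑-cong (refinements (u ++ v)) (λ γ γ∈ → Φ-++ pα pβ
           (subst (λ k → IsComp k γ) (length-++ u) (∈refinements⇒IsComp (u ++ v) γ∈))) ⟩
    (∑[ refinements (u ++ v) ] λ γ → ∑[ splits γ ] λ p →
      [ size (proj₁ p) ≡ᵇ length u ]· (Φ (proj₁ p) α * Φ (proj₂ p) β))
      ≡⟨ ∑-refinements-++ u v (λ γ₁ γ₂ → Φ γ₁ α * Φ γ₂ β) ⟩
    (∑[ refinements u ] λ γ₁ → ∑[ refinements v ] λ γ₂ → Φ γ₁ α * Φ γ₂ β)
      ≡⟨ ∑-product (refinements u) (refinements v) (λ γ₁ → Φ γ₁ α) (λ γ₂ → Φ γ₂ β) ⟩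
    Ψ u α * Ψ v β ∎

  ψ-shuffles : ∀ u v → Disjoint u v → ψ u * ψ v ≡ (∑[ shuffles u v ] ψ)
  ψ-shuffles u v dis = begin
    ψ u * ψ v
      ≡⟨ ∑-product (refinements u) (refinements v) (λ α → Φ α (top (length u))) (λ β → Φ β (top (length v))) ⟨
    (∑[ refinements u ] λ α → ∑[ refinements v ] λ β → Φ α (top (length u)) * Φ β (top (length v)))
      ≡⟨ ∑-cong (refinements u) (λ α α∈ → ∑-cong (refinements v) λ β β∈ →
           sym (∑-qsh-Φ-top (∈refinements⇒IsComp u α∈) (∈refinements⇒IsComp v β∈))) ⟩
    ∑∑-qsh u v (λ γ → Φ γ (top (length u ℕ.+ length v)))
      ≡⟨ ∑-qsh≡∑-shuffles u v _ dis ⟩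
    (∑[ shuffles u v ] λ w → Ψ w (top (length u ℕ.+ length v)))
      ≡⟨ ∑-cong (shuffles u v) (λ w w∈ → cong (λ k → Ψ w (top k)) (sym (∈shuffles⇒length u v w∈))) ⟩
    (∑[ shuffles u v ] ψ) ∎

  ψ-[] : ψ [] ≡ 1ℚ
  ψ-[] = trans (∑-refinements-[] _) unit

  ψ-[_] : ∀ x → ψ (x ∷ []) ≡ lam Φ
  ψ-[ x ] = ∑-refinements-[ x ] _

-- Permutations

-- `perms` for an arbitrary word in place of `downFrom n`, so that inductions can remove letters or
-- whole segments from the word.
arrangements : List ℕ → List (List ℕ)
arrangements []      = [] ∷ []
arrangements (x ∷ w) = concatMap (insertions x) (arrangements w)

perms≡arrangements : ∀ n → perms n ≡ arrangements (downFrom n)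
perms≡arrangements zero    = refl
perms≡arrangements (suc n) = cong (concatMap (insertions n)) (perms≡arrangements n)

∈insertions⇒↭ : ∀ x ρ′ {ρ} → ρ ∈ insertions x ρ′ → ρ ↭ x ∷ ρ′
∈insertions⇒↭ x []       (here refl) = ↭-refl
∈insertions⇒↭ x (z ∷ zs) (here refl) = ↭-refl
∈insertions⇒↭ x (z ∷ zs) (there ρ∈) with ∈-map⁻ (z ∷_) ρ∈
... | σ , σ∈ , refl = ↭-trans (↭-prep z (∈insertions⇒↭ x zs σ∈)) (↭-swap z x ↭-refl)

∈arrangements⇒↭ : ∀ w {ρ} → ρ ∈ arrangements w → ρ ↭ w
∈arrangements⇒↭ []      (here refl) = ↭-refl
∈arrangements⇒↭ (x ∷ w) ρ∈ with find (∈-concatMap⁻ (insertions x) {xs = arrangements w} ρ∈)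
... | ρ′ , ρ′∈ , ρ∈ins = ↭-trans (∈insertions⇒↭ x ρ′ ρ∈ins) (↭-prep x (∈arrangements⇒↭ w ρ′∈))

∈-insertions : ∀ x ps qs → ps ++ x ∷ qs ∈ insertions x (ps ++ qs)
∈-insertions x []       []       = here refl
∈-insertions x []       (q ∷ qs) = here refl
∈-insertions x (p ∷ ps) qs       = there (∈-map⁺ (p ∷_) (∈-insertions x ps qs))

↭⇒∈arrangements : ∀ w {ρ} → ρ ↭ w → ρ ∈ arrangements w
↭⇒∈arrangements []      ρ↭ = here (↭-empty-inv ρ↭)
↭⇒∈arrangements (x ∷ w) ρ↭ with ∈-∃++ (∈-resp-↭ (↭-sym ρ↭) (here refl))
... | ps , qs , refl =
  ∈-concatMap⁺ (insertions x) (lose (↭⇒∈arrangements w (drop-mid ps [] ρ↭)) (∈-insertions x ps qs))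

Unique-resp-↭ : ∀ {xs ys : List ℕ} → xs ↭ ys → Unique xs → Unique ys
Unique-resp-↭ p = ↭ₛ.Unique-resp-↭ (setoid ℕ) (↭⇒↭ₛ p)

AllPairs-map-∈ : ∀ {A : Set} {R S : A → A → Set} {xs : List A} →
  (∀ {x y} → x ∈ xs → y ∈ xs → R x y → S x y) → AllPairs R xs → AllPairs S xs
AllPairs-map-∈ f []       = []
AllPairs-map-∈ f (r ∷ rs) =
  All.tabulate (λ y∈ → f (here refl) (there y∈) (All.lookup r y∈))
  ∷ AllPairs-map-∈ (λ x∈ y∈ → f (there x∈) (there y∈)) rs

Unique-map-∈ : ∀ {A B : Set} (f : A → B) {xs : List A} →
  (∀ {x y} → x ∈ xs → y ∈ xs → f x ≡ f y → x ≡ y) → Unique xs → Unique (map f xs)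
Unique-map-∈ f inj xs! = AllPairs.map⁺ (AllPairs-map-∈ (λ x∈ y∈ x≢y fx≡fy → x≢y (inj x∈ y∈ fx≡fy)) xs!)

Unique-insertions : ∀ x ρ → x ∉ ρ → Unique (insertions x ρ)
Unique-insertions x []       _  = [] ∷ []
Unique-insertions x (z ∷ zs) x∉ =
  All.map⁺ (All.tabulate λ { _ refl → x∉ (here refl) })
  ∷ Unique.map⁺ ∷-injectiveʳ (Unique-insertions x zs (x∉ ∘ there))

-- A left inverse of inserting `x`: it shows that insertions into different words have no result in
-- common, whence `Unique-arrangements`.
erase : ℕ → List ℕ → List ℕ
erase x = filterᵇ (λ y → not (x ≡ᵇ y))

erase-∉ : ∀ x ρ → x ∉ ρ → erase x ρ ≡ ρ
erase-∉ x []      _  = refl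
erase-∉ x (z ∷ ρ) x∉ rewrite ≢⇒≡ᵇ-false {x} {z} (x∉ ∘ here) = cong (z ∷_) (erase-∉ x ρ (x∉ ∘ there))

erase-∷ : ∀ x ρ → erase x (x ∷ ρ) ≡ erase x ρ
erase-∷ x ρ rewrite ≡ᵇ-refl x = refl

erase-insertions : ∀ x ρ {σ} → x ∉ ρ → σ ∈ insertions x ρ → erase x σ ≡ ρ
erase-insertions x []       x∉ (here refl) = erase-∷ x []
erase-insertions x (z ∷ zs) x∉ (here refl) = trans (erase-∷ x (z ∷ zs)) (erase-∉ x (z ∷ zs) x∉)
erase-insertions x (z ∷ zs) x∉ (there σ∈) with ∈-map⁻ (z ∷_) σ∈
... | σ′ , σ′∈ , refl rewrite ≢⇒≡ᵇ-false {x} {z} (x∉ ∘ here) =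
  cong (z ∷_) (erase-insertions x zs (x∉ ∘ there) σ′∈)

∉arrangements : ∀ {x w ρ} → Unique (x ∷ w) → ρ ∈ arrangements w → x ∉ ρ
∉arrangements {w = w} xw! ρ∈ x∈ρ =
  Unique.Unique[x∷xs]⇒x∉xs xw! (∈-resp-↭ (∈arrangements⇒↭ w ρ∈) x∈ρ)

Unique-arrangements : ∀ {w} → Unique w → Unique (arrangements w)
Unique-arrangements {[]}    _               = [] ∷ []
Unique-arrangements {x ∷ w} xw!@(_ ∷ w!) = Unique.concat⁺
  (All.map⁺ (All.tabulate λ {ρ} ρ∈ → Unique-insertions x ρ (∉arrangements xw! ρ∈)))
  (AllPairs.map⁺ (AllPairs-map-∈
    (λ {ρ} {ρ′} ρ∈ ρ′∈ ρ≢ρ′ (σ∈ , σ∈′) → ρ≢ρ′ (trans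
      (sym (erase-insertions x ρ (∉arrangements xw! ρ∈) σ∈))
      (erase-insertions x ρ′ (∉arrangements xw! ρ′∈) σ∈′)))
    (Unique-arrangements w!)))

downFrom↭upTo : ∀ n → downFrom n ↭ upTo n
downFrom↭upTo n = ↭-trans (↭-reflexive (sym (reverse-upTo n))) (↭-reverse (upTo n))

∈perms⇒↭ : ∀ n {σ} → σ ∈ perms n → σ ↭ upTo n
∈perms⇒↭ n σ∈ = ↭-trans
  (∈arrangements⇒↭ (downFrom n) (subst (_ ∈_) (perms≡arrangements n) σ∈)) (downFrom↭upTo n)

↭⇒∈perms : ∀ n {σ} → σ ↭ upTo n → σ ∈ perms n
↭⇒∈perms n σ↭ = subst (_ ∈_) (sym (perms≡arrangements n))
  (↭⇒∈arrangements (downFrom n) (↭-trans σ↭ (↭-sym (downFrom↭upTo n))))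

Unique-perms : ∀ n → Unique (perms n)
Unique-perms n = subst Unique (sym (perms≡arrangements n)) (Unique-arrangements (Unique.downFrom⁺ n))

-- Inverses and composition in one-line notation

indexOf-≡ : ∀ {i x} xs → i ≡ x → indexOf i (x ∷ xs) ≡ 0
indexOf-≡ {i} {x} xs i≡x with i ℕ.≟ x
... | yes _   = refl
... | no  i≢x = ⊥-elim (i≢x i≡x)

indexOf-≢ : ∀ {i x} xs → i ≢ x → indexOf i (x ∷ xs) ≡ suc (indexOf i xs)
indexOf-≢ {i} {x} xs i≢x with i ℕ.≟ x
... | yes i≡x = ⊥-elim (i≢x i≡x)
... | no  _   = refl

at-indexOf : ∀ {i σ} → i ∈ σ → at σ (indexOf i σ) ≡ i
at-indexOf {i} {x ∷ σ} i∈ with i ℕ.≟ x | i∈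
... | yes i≡x | _         = sym i≡x
... | no  i≢x | here i≡x  = ⊥-elim (i≢x i≡x)
... | no  _   | there i∈σ = at-indexOf i∈σ

at-∈ : ∀ σ {i} → i ℕ.< length σ → at σ i ∈ σ
at-∈ (x ∷ σ) {zero}  _       = here refl
at-∈ (x ∷ σ) {suc i} (s≤s l) = there (at-∈ σ l)

indexOf-at : ∀ {σ i} → Unique σ → i ℕ.< length σ → indexOf (at σ i) σ ≡ i
indexOf-at {x ∷ σ} {zero}  _          _       = indexOf-≡ σ refl
indexOf-at {x ∷ σ} {suc i} (x∉ ∷ σ!) (s≤s l) =
  trans (indexOf-≢ σ λ at≡x → All.lookup x∉ (at-∈ σ l) (sym at≡x)) (cong suc (indexOf-at σ! l))

indexOf-< : ∀ {i σ} → i ∈ σ → indexOf i σ ℕ.< length σ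
indexOf-< {i} {x ∷ σ} i∈ with i ℕ.≟ x | i∈
... | yes _   | _         = s≤s ℕ.z≤n
... | no  i≢x | here i≡x  = ⊥-elim (i≢x i≡x)
... | no  _   | there i∈σ = s≤s (indexOf-< i∈σ)

at-map : ∀ (f : ℕ → ℕ) σ {i} → i ℕ.< length σ → at (map f σ) i ≡ f (at σ i)
at-map f (x ∷ σ) {zero}  _       = refl
at-map f (x ∷ σ) {suc i} (s≤s l) = at-map f σ l

at-applyUpTo : ∀ (f : ℕ → ℕ) n {i} → i ℕ.< n → at (applyUpTo f n) i ≡ f i
at-applyUpTo f (suc n) {zero}  _       = refl
at-applyUpTo f (suc n) {suc i} (s≤s l) = at-applyUpTo (f ∘ suc) n l

map-at-upTo : ∀ σ → map (at σ) (upTo (length σ)) ≡ σ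
map-at-upTo []      = refl
map-at-upTo (x ∷ σ) = cong (x ∷_) (begin
  map (at (x ∷ σ)) (applyUpTo suc (length σ)) ≡⟨ map-applyUpTo suc (at (x ∷ σ)) (length σ) ⟩
  applyUpTo (at σ) (length σ)                 ≡⟨ map-upTo (at σ) (length σ) ⟨
  map (at σ) (upTo (length σ))                ≡⟨ map-at-upTo σ ⟩
  σ ∎)

-- For permutations, positions ρ π is the one-line notation of ρ⁻¹π.
positions : List ℕ → List ℕ → List ℕ
positions ρ = map (λ i → indexOf i ρ)

positions-self : ∀ {σ} → Unique σ → positions σ σ ≡ upTo (length σ)
positions-self {σ} σ! = begin
  positions σ σ                                  ≡⟨ cong (positions σ) (map-at-upTo σ) ⟨
  positions σ (map (at σ) (upTo (length σ)))     ≡⟨ map-∘ (upTo (length σ)) ⟨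
  map (λ i → indexOf (at σ i) σ) (upTo (length σ))
    ≡⟨ map-id-local (All.tabulate λ i∈ → indexOf-at σ! (∈-upTo⁻ i∈)) ⟩
  upTo (length σ) ∎

module _ {n : ℕ} where
  length-perm : ∀ {σ} → σ ↭ upTo n → length σ ≡ n
  length-perm σ↭ = trans (↭-length σ↭) (length-upTo n)

  Unique-perm : ∀ {σ} → σ ↭ upTo n → Unique σ
  Unique-perm σ↭ = Unique-resp-↭ (↭-sym σ↭) (Unique.upTo⁺ n)

  <⇒∈perm : ∀ {σ i} → σ ↭ upTo n → i ℕ.< n → i ∈ σ
  <⇒∈perm σ↭ i<n = ∈-resp-↭ (↭-sym σ↭) (∈-upTo⁺ i<n)

  ∈perm⇒< : ∀ {σ i} → σ ↭ upTo n → i ∈ σ → i ℕ.< n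
  ∈perm⇒< σ↭ i∈ = ∈-upTo⁻ (∈-resp-↭ σ↭ i∈)

  positions-perm : ∀ {ρ w} → ρ ↭ upTo n → w ↭ upTo n → positions ρ w ↭ upTo n
  positions-perm {ρ} {w} ρ↭ w↭ = ↭-trans (↭-map⁺ _ (↭-trans w↭ (↭-sym ρ↭)))
    (↭-reflexive (trans (positions-self (Unique-perm ρ↭)) (cong upTo (length-perm ρ↭))))

  inv-upTo : ∀ {σ} → σ ↭ upTo n → inv σ ≡ positions σ (upTo n)
  inv-upTo {σ} σ↭ = cong (positions σ ∘ upTo) (length-perm σ↭)

  inv-perm : ∀ {σ} → σ ↭ upTo n → inv σ ↭ upTo n
  inv-perm σ↭ = ↭-trans (↭-reflexive (inv-upTo σ↭)) (positions-perm σ↭ ↭-refl)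

  ∘ₚ-perm : ∀ {σ τ} → σ ↭ upTo n → τ ↭ upTo n → (σ ∘ₚ τ) ↭ upTo n
  ∘ₚ-perm {σ} σ↭ τ↭ = ↭-trans (↭-map⁺ (at σ) τ↭) (↭-trans (↭-reflexive
    (trans (cong (map (at σ) ∘ upTo) (sym (length-perm σ↭))) (map-at-upTo σ))) σ↭)

  at-inv : ∀ {σ i} → σ ↭ upTo n → i ℕ.< n → at (inv σ) i ≡ indexOf i σ
  at-inv {σ} {i} σ↭ i<n = begin
    at (inv σ) i                ≡⟨ cong (λ τ → at τ i) (inv-upTo σ↭) ⟩
    at (positions σ (upTo n)) i ≡⟨ at-map _ (upTo n) (subst (i ℕ.<_) (sym (length-upTo n)) i<n) ⟩
    indexOf (at (upTo n) i) σ   ≡⟨ cong (λ j → indexOf j σ) (at-applyUpTo (λ j → j) n i<n) ⟩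
    indexOf i σ                 ∎

  indexOf-inv : ∀ {σ i} → σ ↭ upTo n → i ℕ.< n → indexOf i (inv σ) ≡ at σ i
  indexOf-inv {σ} {i} σ↭ i<n = begin
    indexOf i (inv σ)                     ≡⟨ cong (λ j → indexOf j (inv σ)) (indexOf-at (Unique-perm σ↭) i<|σ|) ⟨
    indexOf (indexOf (at σ i) σ) (inv σ)  ≡⟨ cong (λ j → indexOf j (inv σ)) (at-inv σ↭ at<n) ⟨
    indexOf (at (inv σ) (at σ i)) (inv σ) ≡⟨ indexOf-at (Unique-perm (inv-perm σ↭))
                                               (subst (at σ i ℕ.<_) (sym (length-perm (inv-perm σ↭))) at<n) ⟩
    at σ i                                ∎
    where
    i<|σ| : i ℕ.< length σ
    i<|σ| = subst (i ℕ.<_) (sym (length-perm σ↭)) i<n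
    at<n : at σ i ℕ.< n
    at<n = ∈perm⇒< σ↭ (at-∈ σ i<|σ|)

  inv-inv : ∀ {σ} → σ ↭ upTo n → inv (inv σ) ≡ σ
  inv-inv {σ} σ↭ = begin
    inv (inv σ)                  ≡⟨ inv-upTo (inv-perm σ↭) ⟩
    positions (inv σ) (upTo n)   ≡⟨ map-cong-local (All.tabulate λ i∈ → indexOf-inv σ↭ (∈-upTo⁻ i∈)) ⟩
    map (at σ) (upTo n)          ≡⟨ cong (map (at σ) ∘ upTo) (length-perm σ↭) ⟨
    map (at σ) (upTo (length σ)) ≡⟨ map-at-upTo σ ⟩
    σ                            ∎

  -- The substitutions τ = ρ⁻¹π and ρ = (τπ⁻¹)⁻¹ undo each other; this is one half and
  -- `positions-inv-∘ₚ-inv` the other.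
  inv-positions-∘ₚ-inv : ∀ {ρ π} → ρ ↭ upTo n → π ↭ upTo n → inv (positions ρ π ∘ₚ inv π) ≡ ρ
  inv-positions-∘ₚ-inv {ρ} {π} ρ↭ π↭ = trans (cong inv (begin
    map (at (positions ρ π)) (inv π)                       ≡⟨ cong (map (at (positions ρ π))) (inv-upTo π↭) ⟩
    map (at (positions ρ π)) (positions π (upTo n))        ≡⟨ map-∘ (upTo n) ⟨
    map (λ i → at (positions ρ π) (indexOf i π)) (upTo n)  ≡⟨ map-cong-local (All.tabulate λ i∈ → pointwise (∈-upTo⁻ i∈)) ⟩
    positions ρ (upTo n)                                   ≡⟨ inv-upTo ρ↭ ⟨
    inv ρ                                                  ∎)) (inv-inv ρ↭)
    where
    pointwise : ∀ {i} → i ℕ.< n → at (positions ρ π) (indexOf i π) ≡ indexOf i ρ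
    pointwise i<n = trans (at-map _ π (indexOf-< (<⇒∈perm π↭ i<n)))
      (cong (λ j → indexOf j ρ) (at-indexOf (<⇒∈perm π↭ i<n)))

  positions-inv-∘ₚ-inv : ∀ {τ π} → τ ↭ upTo n → π ↭ upTo n → positions (inv (τ ∘ₚ inv π)) π ≡ τ
  positions-inv-∘ₚ-inv {τ} {π} τ↭ π↭ = begin
    positions (inv (τ ∘ₚ inv π)) π    ≡⟨ map-cong-local (All.tabulate λ i∈ → pointwise (∈perm⇒< π↭ i∈)) ⟩
    map (λ i → at τ (indexOf i π)) π  ≡⟨ map-∘ π ⟩
    map (at τ) (positions π π)        ≡⟨ cong (map (at τ)) (positions-self (Unique-perm π↭)) ⟩
    map (at τ) (upTo (length π))      ≡⟨ cong (map (at τ) ∘ upTo) (trans (length-perm π↭) (sym (length-perm τ↭))) ⟩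
    map (at τ) (upTo (length τ))      ≡⟨ map-at-upTo τ ⟩
    τ                                 ∎
    where
    pointwise : ∀ {i} → i ℕ.< n → indexOf i (inv (τ ∘ₚ inv π)) ≡ at τ (indexOf i π)
    pointwise {i} i<n = begin
      indexOf i (inv (τ ∘ₚ inv π)) ≡⟨ indexOf-inv (∘ₚ-perm τ↭ (inv-perm π↭)) i<n ⟩
      at (τ ∘ₚ inv π) i            ≡⟨ at-map (at τ) (inv π) (subst (i ℕ.<_) (sym (length-perm (inv-perm π↭))) i<n) ⟩
      at τ (at (inv π) i)          ≡⟨ cong (at τ) (at-inv π↭ i<n) ⟩
      at τ (indexOf i π)           ∎

  perms↭positions : ∀ {π} → π ↭ upTo n → perms n ↭ map (λ ρ → positions ρ π) (arrangements π)
  perms↭positions {π} π↭ = ∼bag⇒↭ (unique∧set⇒bag (Unique-perms n)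
    (Unique-map-∈ (λ ρ → positions ρ π)
      (λ ρ∈ ρ′∈ eq → trans (sym (inv-positions-∘ₚ-inv (perm ρ∈) π↭))
        (trans (cong (λ τ → inv (τ ∘ₚ inv π)) eq) (inv-positions-∘ₚ-inv (perm ρ′∈) π↭)))
      (Unique-arrangements (Unique-perm π↭)))
    (mk⇔ to from))
    where
    perm : ∀ {ρ} → ρ ∈ arrangements π → ρ ↭ upTo n
    perm ρ∈ = ↭-trans (∈arrangements⇒↭ π ρ∈) π↭

    to : ∀ {τ} → τ ∈ perms n → τ ∈ map (λ ρ → positions ρ π) (arrangements π)
    to {τ} τ∈ = subst (_∈ map (λ ρ → positions ρ π) (arrangements π)) (positions-inv-∘ₚ-inv (∈perms⇒↭ n τ∈) π↭)
      (∈-map⁺ (λ ρ → positions ρ π) (↭⇒∈arrangements π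
        (↭-trans (inv-perm (∘ₚ-perm (∈perms⇒↭ n τ∈) (inv-perm π↭))) (↭-sym π↭))))

    from : ∀ {τ} → τ ∈ map (λ ρ → positions ρ π) (arrangements π) → τ ∈ perms n
    from τ∈ with ∈-map⁻ (λ ρ → positions ρ π) τ∈
    ... | ρ , ρ∈ , refl = ↭⇒∈perms n (positions-perm (perm ρ∈) π↭)

  -- The change of variables from the target τ of a transition to the permutation ρ = (τπ⁻¹)⁻¹ whose
  -- probability `K` assigns to it.
  ∑-perms : ∀ {π} → π ↭ upTo n → (F : List ℕ → List ℕ → ℚ) →
    (∑[ perms n ] λ τ → F τ (inv (τ ∘ₚ inv π))) ≡ (∑[ arrangements π ] λ ρ → F (positions ρ π) ρ)
  ∑-perms {π} π↭ F = begin
    (∑[ perms n ] λ τ → F τ (inv (τ ∘ₚ inv π)))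
      ≡⟨ ∑-↭ _ (perms↭positions π↭) ⟩
    (∑[ map (λ ρ → positions ρ π) (arrangements π) ] λ τ → F τ (inv (τ ∘ₚ inv π)))
      ≡⟨ ∑-map _ (arrangements π) _ ⟩
    (∑[ arrangements π ] λ ρ → F (positions ρ π) (inv (positions ρ π ∘ₚ inv π)))
      ≡⟨ ∑-cong (arrangements π) (λ ρ ρ∈ → cong (F (positions ρ π))
           (inv-positions-∘ₚ-inv (↭-trans (∈arrangements⇒↭ π ρ∈) π↭) π↭)) ⟩
    (∑[ arrangements π ] λ ρ → F (positions ρ π) ρ) ∎

-- Shuffles of the segments of a word

-- `D` uses its letters only through comparisons.
D-cong : ∀ (f g : ℕ → ℕ) w →
  (∀ {a b} → a ∈ w → b ∈ w → (f b <ᵇ f a) ≡ (g b <ᵇ g a)) → D (map f w) ≡ D (map g w)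
D-cong f g []          _    = refl
D-cong f g (x ∷ [])    _    = refl
D-cong f g (x ∷ y ∷ w) same = begin
  D (map f (x ∷ y ∷ w))
    ≡⟨ D-∷∷ (f x) (f y) (map f w) ⟩
  (if f y <ᵇ f x then 1 ∷ D (map f (y ∷ w)) else bump (D (map f (y ∷ w))))
    ≡⟨ cong₂ (λ b δ → if b then 1 ∷ δ else bump δ) (same (here refl) (there (here refl)))
         (D-cong f g (y ∷ w) λ a∈ b∈ → same (there a∈) (there b∈)) ⟩
  (if g y <ᵇ g x then 1 ∷ D (map g (y ∷ w)) else bump (D (map g (y ∷ w))))
    ≡⟨ D-∷∷ (g x) (g y) (map g w) ⟨
  D (map g (x ∷ y ∷ w)) ∎

-- Inserting `x` shifts the positions of other letters but not their order.
insertions-order : ∀ x ρ′ {ρ a b} → ρ ∈ insertions x ρ′ → a ≢ x → b ≢ x →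
  (indexOf b ρ <ᵇ indexOf a ρ) ≡ (indexOf b ρ′ <ᵇ indexOf a ρ′)
insertions-order x []       (here refl) a≢x b≢x rewrite indexOf-≢ [] a≢x | indexOf-≢ [] b≢x = refl
insertions-order x (z ∷ zs) (here refl) a≢x b≢x
  rewrite indexOf-≢ (z ∷ zs) a≢x | indexOf-≢ (z ∷ zs) b≢x = refl
insertions-order x (z ∷ zs) {a = a} {b} (there ρ∈) a≢x b≢x with ∈-map⁻ (z ∷_) ρ∈
... | σ , σ∈ , refl with a ℕ.≟ z | b ℕ.≟ z
...   | yes _ | yes _ = refl
...   | yes _ | no  _ = refl
...   | no  _ | yes _ = refl
...   | no  _ | no  _ = insertions-order x zs σ∈ a≢x b≢x

D-positions-insertions : ∀ {x ρ′ ρ} w → x ∉ w → ρ ∈ insertions x ρ′ → D (positions ρ w) ≡ D (positions ρ′ w)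
D-positions-insertions {x} {ρ′} w x∉ ρ∈ = D-cong _ _ w λ a∈ b∈ →
  insertions-order x ρ′ ρ∈ (λ { refl → x∉ a∈ }) (λ { refl → x∉ b∈ })

∑-insertions-∷ : ∀ x z zs (g : List ℕ → ℚ) →
  (∑[ insertions x (z ∷ zs) ] g) ≡ g (x ∷ z ∷ zs) + (∑[ insertions x zs ] λ ρ → g (z ∷ ρ))
∑-insertions-∷ x z zs g = trans (∑-∷ _ _ g) (cong (g (x ∷ z ∷ zs) +_) (∑-map (z ∷_) (insertions x zs) g))

-- The insertion stops at the first `y`. A word without `y` admits every place, in agreement with
-- `indexOf`, which returns the length for an absent letter.
insertionsBefore : ℕ → ℕ → List ℕ → List (List ℕ)
insertionsBefore x y []       = (x ∷ []) ∷ []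
insertionsBefore x y (z ∷ zs) =
  (x ∷ z ∷ zs) ∷ (if y ≡ᵇ z then [] else map (z ∷_) (insertionsBefore x y zs))

∑-insertionsBefore-≡ : ∀ x y zs (g : List ℕ → ℚ) → (∑[ insertionsBefore x y (y ∷ zs) ] g) ≡ g (x ∷ y ∷ zs)
∑-insertionsBefore-≡ x y zs g rewrite ≡ᵇ-refl y = ∑-[ _ ] g

∑-insertionsBefore-≢ : ∀ x {y z} zs (g : List ℕ → ℚ) → y ≢ z → (∑[ insertionsBefore x y (z ∷ zs) ] g)
  ≡ g (x ∷ z ∷ zs) + (∑[ insertionsBefore x y zs ] λ ρ → g (z ∷ ρ))
∑-insertionsBefore-≢ x {y} {z} zs g y≢z rewrite ≢⇒≡ᵇ-false y≢z =
  trans (∑-∷ _ _ g) (cong (g (x ∷ z ∷ zs) +_) (∑-map (z ∷_) (insertionsBefore x y zs) g))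

∑-insertions-before : ∀ {x} y ρ (g : List ℕ → ℚ) → x ∉ ρ →
  (∑[ insertions x ρ ] λ σ → [ indexOf x σ ≤?ᵇ indexOf y σ ]· g σ) ≡ (∑[ insertionsBefore x y ρ ] g)
∑-insertions-before {x} y [] g x∉ = trans (∑-[ _ ] _)
  (trans (cong (λ i → [ i ≤?ᵇ indexOf y (x ∷ []) ]· g (x ∷ [])) (indexOf-≡ {x} [] refl)) (sym (∑-[ _ ] g)))
∑-insertions-before {x} y (z ∷ zs) g x∉ = trans (∑-insertions-∷ x z zs _) (trans (cong₂ _+_ front rest) (sym split))
  where
  before : ℚ
  before = if y ≡ᵇ z then 0ℚ else (∑[ insertionsBefore x y zs ] λ ρ → g (z ∷ ρ))

  front : [ indexOf x (x ∷ z ∷ zs) ≤?ᵇ indexOf y (x ∷ z ∷ zs) ]· g (x ∷ z ∷ zs) ≡ g (x ∷ z ∷ zs)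
  front = cong (λ i → [ i ≤?ᵇ indexOf y (x ∷ z ∷ zs) ]· g (x ∷ z ∷ zs)) (indexOf-≡ {x} (z ∷ zs) refl)

  split : (∑[ insertionsBefore x y (z ∷ zs) ] g) ≡ g (x ∷ z ∷ zs) + before
  split with y ℕ.≟ z
  ... | yes refl rewrite ≡ᵇ-refl y       = trans (∑-[ _ ] g) (sym (ℚ.+-identityʳ _))
  ... | no  y≢z  rewrite ≢⇒≡ᵇ-false y≢z = trans (∑-∷ _ _ g)
    (cong (g (x ∷ z ∷ zs) +_) (∑-map (z ∷_) (insertionsBefore x y zs) g))

  rest : (∑[ insertions x zs ] λ σ → [ indexOf x (z ∷ σ) ≤?ᵇ indexOf y (z ∷ σ) ]· g (z ∷ σ)) ≡ before
  rest with y ℕ.≟ z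
  -- The head is `y`, at index 0, and `x` is inserted behind it.
  ... | yes refl rewrite ≡ᵇ-refl y = ∑-≡0 (insertions x zs) λ σ _ →
    cong (λ i → [ i ≤?ᵇ 0 ]· g (y ∷ σ)) (indexOf-≢ σ (x∉ ∘ here))
  ... | no  y≢z  rewrite ≢⇒≡ᵇ-false y≢z = trans
    (∑-cong′ (insertions x zs) λ σ →
      cong (λ i → [ i ≤?ᵇ suc (indexOf y σ) ]· g (z ∷ σ)) (indexOf-≢ σ (x∉ ∘ here)))
    (∑-insertions-before y zs (g ∘ (z ∷_)) (x∉ ∘ there))

shuffles-singleton : ∀ x v → shuffles (x ∷ []) v ≡ insertions x v
shuffles-singleton x []      = refl
shuffles-singleton x (z ∷ v) = cong (λ ws → (x ∷ z ∷ v) ∷ map (z ∷_) ws) (shuffles-singleton x v)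

-- The only constraint on `x` in such a shuffle is to precede `y`; `y ∉ v` ensures that the first
-- `y` met in `ρ` is the one from the left word.
∑-shuffles-insertionsBefore : ∀ x y u v (g : List ℕ → ℚ) → y ∉ v →
  (∑[ shuffles (x ∷ y ∷ u) v ] g) ≡ (∑[ shuffles (y ∷ u) v ] λ ρ → ∑[ insertionsBefore x y ρ ] g)
∑-shuffles-insertionsBefore x y u [] g y∉ =
  trans (∑-[ _ ] g) (sym (trans (∑-[ _ ] _) (∑-insertionsBefore-≡ x y u g)))
∑-shuffles-insertionsBefore x y u (z ∷ v) g y∉ = begin
  (∑[ shuffles (x ∷ y ∷ u) (z ∷ v) ] g)
    ≡⟨ ∑-shuffles-∷∷ x (y ∷ u) z v g ⟩
  (∑[ shuffles (y ∷ u) (z ∷ v) ] λ w → g (x ∷ w)) + (∑[ shuffles (x ∷ y ∷ u) v ] λ w → g (z ∷ w))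
    ≡⟨ cong₂ _+_ (∑-shuffles-∷∷ y u z v _) (∑-shuffles-insertionsBefore x y u v (g ∘ (z ∷_)) (y∉ ∘ there)) ⟩
  (Y + Z) + (∑[ shuffles (y ∷ u) v ] λ ρ → ∑[ insertionsBefore x y ρ ] λ σ → g (z ∷ σ))
    ≡⟨ ℚ.+-assoc Y Z _ ⟩
  Y + (Z + (∑[ shuffles (y ∷ u) v ] λ ρ → ∑[ insertionsBefore x y ρ ] λ σ → g (z ∷ σ)))
    ≡⟨ cong₂ _+_ (∑-cong′ (shuffles u (z ∷ v)) λ w → sym (∑-insertionsBefore-≡ x y w g))
         (trans (sym (∑-+ (shuffles (y ∷ u) v) _ _))
           (∑-cong′ (shuffles (y ∷ u) v) λ w → sym (∑-insertionsBefore-≢ x w g (y∉ ∘ here)))) ⟩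
  (∑[ shuffles u (z ∷ v) ] λ w → ∑[ insertionsBefore x y (y ∷ w) ] g)
    + (∑[ shuffles (y ∷ u) v ] λ w → ∑[ insertionsBefore x y (z ∷ w) ] g)
    ≡⟨ ∑-shuffles-∷∷ y u z v _ ⟨
  (∑[ shuffles (y ∷ u) (z ∷ v) ] λ ρ → ∑[ insertionsBefore x y ρ ] g) ∎
  where
  Y Z : ℚ
  Y = ∑[ shuffles u (z ∷ v) ] λ w → g (x ∷ y ∷ w)
  Z = ∑[ shuffles (y ∷ u) v ] λ w → g (x ∷ z ∷ w)

-- The sum of g over the words ρ obtained by shuffling the segments of w whose
-- lengths are the parts of γ: these are the ρ with D(ρ⁻¹w) ≤ γ.
∑-segment-shuffles : List ℕ → List ℕ → (List ℕ → ℚ) → ℚ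
∑-segment-shuffles w γ g = ∑[ arrangements w ] λ ρ → [ D (positions ρ w) ≤ᶜ γ ]· g ρ

-- A cut after `x` leaves its place in `ρ` free, by `D≤1∷`, and the remaining condition does not see
-- `x`.
∑-segment-shuffles-1∷ : ∀ {x w β} (g : List ℕ → ℚ) → x ∉ w → IsComp (length w) β →
  ∑-segment-shuffles (x ∷ w) (1 ∷ β) g ≡ ∑-segment-shuffles w β (λ ρ → ∑[ insertions x ρ ] g)
∑-segment-shuffles-1∷ {x} {w} {β} g x∉ p = trans (∑-concatMap (insertions x) (arrangements w) _)
  (∑-cong′ (arrangements w) λ ρ′ → trans
    (∑-cong (insertions x ρ′) λ ρ ρ∈ → cong ([_]· g ρ) (trans (drop-first w p ρ)
      (cong (_≤ᶜ β) (D-positions-insertions w x∉ ρ∈))))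
    (∑-[]· (D (positions ρ′ w) ≤ᶜ β) (insertions x ρ′) g))
  where
  drop-first : ∀ w {β} → IsComp (length w) β → ∀ ρ → D (positions ρ (x ∷ w)) ≤ᶜ (1 ∷ β) ≡ D (positions ρ w) ≤ᶜ β
  drop-first []      [] ρ = refl
  drop-first (y ∷ w) p  ρ = D≤1∷ (indexOf x ρ) (indexOf y ρ) (positions ρ w) p

-- Without a cut, `D≤bump` requires `x` to stand before its successor `y` in `ρ`.
∑-segment-shuffles-bump : ∀ {x y w β} (g : List ℕ → ℚ) → Unique (x ∷ y ∷ w) → IsComp (suc (length w)) β →
  ∑-segment-shuffles (x ∷ y ∷ w) (bump β) g
  ≡ ∑-segment-shuffles (y ∷ w) β (λ ρ → ∑[ insertionsBefore x y ρ ] g)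
∑-segment-shuffles-bump {x} {y} {w} {β} g xyw! p =
  trans (∑-concatMap (insertions x) (arrangements (y ∷ w)) _)
  (∑-cong (arrangements (y ∷ w)) λ ρ′ ρ′∈ → begin
    (∑[ insertions x ρ′ ] λ ρ → [ D (positions ρ (x ∷ y ∷ w)) ≤ᶜ bump β ]· g ρ)
      ≡⟨ ∑-cong (insertions x ρ′) (λ ρ ρ∈ → begin
           [ D (positions ρ (x ∷ y ∷ w)) ≤ᶜ bump β ]· g ρ
             ≡⟨ cong ([_]· g ρ) (D≤bump (indexOf x ρ) (indexOf y ρ) (positions ρ w) p) ⟩
           [ (indexOf x ρ ≤?ᵇ indexOf y ρ) ∧ (D (positions ρ (y ∷ w)) ≤ᶜ β) ]· g ρ
             ≡⟨ []·-∧ (indexOf x ρ ≤?ᵇ indexOf y ρ) _ (g ρ) ⟩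
           [ indexOf x ρ ≤?ᵇ indexOf y ρ ]· [ D (positions ρ (y ∷ w)) ≤ᶜ β ]· g ρ
             ≡⟨ []·-comm (indexOf x ρ ≤?ᵇ indexOf y ρ) _ (g ρ) ⟩
           [ D (positions ρ (y ∷ w)) ≤ᶜ β ]· [ indexOf x ρ ≤?ᵇ indexOf y ρ ]· g ρ
             ≡⟨ cong (λ δ → [ δ ≤ᶜ β ]· [ indexOf x ρ ≤?ᵇ indexOf y ρ ]· g ρ)
                  (D-positions-insertions (y ∷ w) (Unique.Unique[x∷xs]⇒x∉xs xyw!) ρ∈) ⟩
           [ D (positions ρ′ (y ∷ w)) ≤ᶜ β ]· [ indexOf x ρ ≤?ᵇ indexOf y ρ ]· g ρ ∎) ⟩
    (∑[ insertions x ρ′ ] λ ρ → [ D (positions ρ′ (y ∷ w)) ≤ᶜ β ]· [ indexOf x ρ ≤?ᵇ indexOf y ρ ]· g ρ)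
      ≡⟨ ∑-[]· (D (positions ρ′ (y ∷ w)) ≤ᶜ β) (insertions x ρ′) _ ⟩
    [ D (positions ρ′ (y ∷ w)) ≤ᶜ β ]· (∑[ insertions x ρ′ ] λ ρ → [ indexOf x ρ ≤?ᵇ indexOf y ρ ]· g ρ)
      ≡⟨ cong ([ D (positions ρ′ (y ∷ w)) ≤ᶜ β ]·_) (∑-insertions-before y ρ′ g (∉arrangements xyw! ρ′∈)) ⟩
    [ D (positions ρ′ (y ∷ w)) ≤ᶜ β ]· (∑[ insertionsBefore x y ρ′ ] g) ∎)

-- The first segment is put into `ρ` from its last letter back: the last letter goes anywhere, each
-- earlier one before its successor, which amounts to a shuffle.
∑-segment-shuffles-∷ : ∀ x u v {β} (g : List ℕ → ℚ) → Unique (x ∷ u ++ v) → IsComp (length v) β →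
  ∑-segment-shuffles (x ∷ u ++ v) (suc (length u) ∷ β) g
  ≡ ∑-segment-shuffles v β (λ ρ → ∑[ shuffles (x ∷ u) ρ ] g)
∑-segment-shuffles-∷ x [] v {β} g xv! p = trans (∑-segment-shuffles-1∷ g (Unique.Unique[x∷xs]⇒x∉xs xv!) p)
  (∑-cong′ (arrangements v) λ ρ → cong ([ D (positions ρ v) ≤ᶜ β ]·_)
    (cong (λ ws → ∑[ ws ] g) (sym (shuffles-singleton x ρ))))
∑-segment-shuffles-∷ x (y ∷ u) v {β} g xyuv!@(_ ∷ yuv!) p = begin
  ∑-segment-shuffles (x ∷ y ∷ u ++ v) (suc (suc (length u)) ∷ β) g
    ≡⟨ ∑-segment-shuffles-bump g xyuv!
         (subst (λ k → IsComp (suc k) (suc (length u) ∷ β)) (sym (length-++ u)) (length u ∷ p)) ⟩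
  ∑-segment-shuffles (y ∷ u ++ v) (suc (length u) ∷ β) (λ ρ → ∑[ insertionsBefore x y ρ ] g)
    ≡⟨ ∑-segment-shuffles-∷ y u v _ yuv! p ⟩
  ∑-segment-shuffles v β (λ ρ → ∑[ shuffles (y ∷ u) ρ ] λ σ → ∑[ insertionsBefore x y σ ] g)
    ≡⟨ ∑-cong (arrangements v) (λ ρ ρ∈ → cong ([ D (positions ρ v) ≤ᶜ β ]·_)
         (∑-shuffles-insertionsBefore x y u ρ g (y∉ρ ρ∈))) ⟨
  ∑-segment-shuffles v β (λ ρ → ∑[ shuffles (x ∷ y ∷ u) ρ ] g) ∎
  where
  y∉ρ : ∀ {ρ} → ρ ∈ arrangements v → y ∉ ρ
  y∉ρ ρ∈ y∈ρ = Unique.Unique[x∷xs]⇒x∉xs yuv! (∈-++⁺ʳ u (∈-resp-↭ (∈arrangements⇒↭ v ρ∈) y∈ρ))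

-- The finest composition

ones : ℕ → List ℕ
ones n = replicate n 1

IsComp-ones : ∀ n → IsComp n (ones n)
IsComp-ones zero    = []
IsComp-ones (suc n) = 0 ∷ IsComp-ones n

-- All segments are single letters, so every arrangement is a shuffle of them.
∑-segment-shuffles-ones : ∀ w (g : List ℕ → ℚ) → Unique w →
  ∑-segment-shuffles w (ones (length w)) g ≡ (∑[ arrangements w ] g)
∑-segment-shuffles-ones []      g _              = trans (∑-[ _ ] _) (sym (∑-[ _ ] g))
∑-segment-shuffles-ones (x ∷ w) g xw!@(_ ∷ w!) = begin
  ∑-segment-shuffles (x ∷ w) (ones (suc (length w))) g
    ≡⟨ ∑-segment-shuffles-1∷ g (Unique.Unique[x∷xs]⇒x∉xs xw!) (IsComp-ones (length w)) ⟩
  ∑-segment-shuffles w (ones (length w)) (λ ρ → ∑[ insertions x ρ ] g)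
    ≡⟨ ∑-segment-shuffles-ones w _ w! ⟩
  (∑[ arrangements w ] λ ρ → ∑[ insertions x ρ ] g)
    ≡⟨ ∑-concatMap (insertions x) (arrangements w) g ⟨
  (∑[ arrangements (x ∷ w) ] g) ∎

length-+⁻ : ∀ j {m} (w : List ℕ) → length w ≡ j ℕ.+ m →
  ∃[ u ] ∃[ v ] (w ≡ u ++ v × length u ≡ j × length v ≡ m)
length-+⁻ zero    w       eq = [] , w , refl , refl , eq
length-+⁻ (suc j) (x ∷ w) eq with length-+⁻ j w (ℕ.suc-injective eq)
... | u , v , refl , |u|≡j , |v|≡m = x ∷ u , v , refl , cong suc |u|≡j , |v|≡m

module SegmentShuffles {Φ : List ℕ → List ℕ → ℚ} (Φ-hopf : IsHopfEnd Φ) where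
  open HopfEnd Φ-hopf public

  Ψ≡∑-segment-shuffles : ∀ {n γ} → IsComp n γ → ∀ w → length w ≡ n → Unique w →
    Ψ w γ ≡ ∑-segment-shuffles w γ ψ
  Ψ≡∑-segment-shuffles [] [] _ _ = trans (∑-refinements-[] _)
    (sym (trans (∑-[ _ ] _) (∑-refinements-[] _)))
  Ψ≡∑-segment-shuffles (a ∷ p) w |w|≡n w! with length-+⁻ (suc a) w |w|≡n
  Ψ≡∑-segment-shuffles (_∷_ a {α = β} p) _ _ w! | x ∷ u , v , refl , refl , refl = begin
    Ψ (x ∷ u ++ v) (suc (length u) ∷ β)
      ≡⟨ Ψ-++ (x ∷ u) v (IsComp-top (suc (length u))) p ⟩
    ψ (x ∷ u) * Ψ v β
      ≡⟨ cong (ψ (x ∷ u) *_) (Ψ≡∑-segment-shuffles p v refl (Unique-++⁻ʳ (x ∷ u) w!)) ⟩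
    ψ (x ∷ u) * ∑-segment-shuffles v β ψ
      ≡⟨ ∑-*ˡ (arrangements v) (ψ (x ∷ u)) _ ⟨
    (∑[ arrangements v ] λ ρ → ψ (x ∷ u) * [ D (positions ρ v) ≤ᶜ β ]· ψ ρ)
      ≡⟨ ∑-cong (arrangements v) (λ ρ ρ∈ → trans (sym ([]·-*ˡ (D (positions ρ v) ≤ᶜ β) (ψ (x ∷ u)) (ψ ρ)))
           (cong ([ D (positions ρ v) ≤ᶜ β ]·_) (ψ-shuffles (x ∷ u) ρ
             λ (i , j) → Unique-++⇒Disjoint (x ∷ u) w! (i , ∈-resp-↭ (∈arrangements⇒↭ v ρ∈) j)))) ⟩
    ∑-segment-shuffles v β (λ ρ → ∑[ shuffles (x ∷ u) ρ ] ψ)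
      ≡⟨ ∑-segment-shuffles-∷ x u v ψ w! p ⟨
    ∑-segment-shuffles (x ∷ u ++ v) (suc (length u) ∷ β) ψ ∎
    where
    Unique-++⁻ʳ : ∀ xs {ys : List ℕ} → Unique (xs ++ ys) → Unique ys
    Unique-++⁻ʳ []       ys!       = ys!
    Unique-++⁻ʳ (_ ∷ xs) (_ ∷ xs!) = Unique-++⁻ʳ xs xs!

    Unique-++⇒Disjoint : ∀ xs {ys : List ℕ} → Unique (xs ++ ys) → Disjoint xs ys
    Unique-++⇒Disjoint (x ∷ xs) xs!       (here refl , j) = Unique.Unique[x∷xs]⇒x∉xs xs! (∈-++⁺ʳ xs j)
    Unique-++⇒Disjoint (x ∷ xs) (_ ∷ xs!) (there i   , j) = Unique-++⇒Disjoint xs xs! (i , j)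

  Ψ-ones : ∀ w → Ψ w (ones (length w)) ≡ lam Φ ^ℚ length w
  Ψ-ones []      = ψ-[]
  Ψ-ones (x ∷ w) = trans (Ψ-++ (x ∷ []) w (IsComp-top 1) (IsComp-ones (length w)))
    (cong₂ _*_ ψ-[ x ] (Ψ-ones w))

  ∑-arrangements-ψ : ∀ {w} → Unique w → (∑[ arrangements w ] ψ) ≡ lam Φ ^ℚ length w
  ∑-arrangements-ψ {w} w! = trans (sym (∑-segment-shuffles-ones w ψ w!))
    (trans (sym (Ψ≡∑-segment-shuffles (IsComp-ones (length w)) w refl w!)) (Ψ-ones w))

  module _ {n : ℕ} {π : List ℕ} (π∈ : π ∈ perms n) where
    private
      π↭ : π ↭ upTo n
      π↭ = ∈perms⇒↭ n π∈

    ∑-perms-ψ : (∑[ perms n ] λ τ → ψ (inv (τ ∘ₚ inv π))) ≡ lam Φ ^ℚ n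
    ∑-perms-ψ = trans (∑-perms π↭ (λ _ → ψ)) (trans (∑-arrangements-ψ (Unique-perm π↭))
      (cong (lam Φ ^ℚ_) (length-perm π↭)))

    Ψ≡∑-perms : ∀ {γ} → IsComp n γ →
      Ψ π γ ≡ (∑[ perms n ] λ τ → [ D τ ≤ᶜ γ ]· ψ (inv (τ ∘ₚ inv π)))
    Ψ≡∑-perms {γ} p = trans (Ψ≡∑-segment-shuffles p π (length-perm π↭) (Unique-perm π↭))
      (sym (∑-perms π↭ (λ τ ρ → [ D τ ≤ᶜ γ ]· ψ ρ)))

-- The lumped chain

-- `(n)` is the least composition, so F_(n) is the only fundamental function containing M_(n). This
-- identifies c_{α,(n)} with a monomial coefficient.
∑-≤top : ∀ n (f : List ℕ → ℚ) → (∑[ comps n ∣ (_≤ᶜ top n) ] f) ≡ f (top n)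
∑-≤top zero          f = ∑-[ [] ] f
∑-≤top (suc zero)    f = ∑-[ 1 ∷ [] ] f
∑-≤top (suc (suc n)) f = begin
  (∑[ comps (2 ℕ.+ n) ∣ (_≤ᶜ top (2 ℕ.+ n)) ] f)
    ≡⟨ ∑-filter (_≤ᶜ top (2 ℕ.+ n)) (comps (2 ℕ.+ n)) f ⟩
  (∑[ comps (2 ℕ.+ n) ] λ δ → [ δ ≤ᶜ top (2 ℕ.+ n) ]· f δ)
    ≡⟨ ∑-comps-suc n _ ⟩
  (∑[ comps (suc n) ] λ ε → [ (1 ∷ ε) ≤ᶜ bump (top (suc n)) ]· f (1 ∷ ε) + [ bump ε ≤ᶜ bump (top (suc n)) ]· f (bump ε))
    ≡⟨ ∑-cong (comps (suc n)) (λ ε ε∈ → trans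
         (cong₂ (λ b b′ → [ b ]· f (1 ∷ ε) + [ b′ ]· f (bump ε))
           (1∷≰bump (∈comps⇒IsComp (suc n) ε∈) (IsComp-top (suc n)))
           (bump≤bump (∈comps⇒IsComp (suc n) ε∈) (IsComp-top (suc n))))
         (ℚ.+-identityˡ _)) ⟩
  (∑[ comps (suc n) ] λ ε → [ ε ≤ᶜ top (suc n) ]· f (bump ε))
    ≡⟨ ∑-filter (_≤ᶜ top (suc n)) (comps (suc n)) (f ∘ bump) ⟨
  (∑[ comps (suc n) ∣ (_≤ᶜ top (suc n)) ] (f ∘ bump))
    ≡⟨ ∑-≤top (suc n) (f ∘ bump) ⟩
  f (top (2 ℕ.+ n)) ∎

-- A first part 1 is produced by prepending a new largest letter, which forces a descent; a longer
-- first part by raising all letters by one and prepending 0, which forbids it.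
D-surjective : ∀ {n α} → IsComp n α → ∃[ π ] (π ↭ upTo n × D π ≡ α)
D-surjective []          = [] , ↭-refl , refl
D-surjective (zero ∷ []) = 0 ∷ [] , ↭-refl , refl
D-surjective (zero ∷ p@(_∷_ b {m} {β} _)) with D-surjective p
... | []    , π↭ , ()
... | y ∷ w , π↭ , Dπ≡ =
  k ∷ y ∷ w ,
  ↭-trans (↭-prep k (↭-trans π↭ (↭-sym (downFrom↭upTo k)))) (downFrom↭upTo (suc k)) ,
  trans (D-∷∷ k y w) (trans (cong (λ i → if i then 1 ∷ D (y ∷ w) else bump (D (y ∷ w))) y<ᵇk) (cong (1 ∷_) Dπ≡))
  where
  k : ℕ
  k = suc b ℕ.+ m
  y<ᵇk : (y <ᵇ k) ≡ true
  y<ᵇk with y <ᵇ k in eq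
  ... | true  = refl
  ... | false = ⊥-elim (subst T eq (ℕ.<⇒<ᵇ (∈perm⇒< π↭ (here refl))))
D-surjective (_∷_ (suc a) {m} {β} p) with D-surjective (a ∷ p)
... | []    , π↭ , ()
... | y ∷ w , π↭ , Dπ≡ =
  0 ∷ map suc (y ∷ w) ,
  ↭-prep 0 (↭-trans (↭-map⁺ suc π↭) (↭-reflexive (map-upTo suc (suc a ℕ.+ m)))) ,
  trans (D-∷∷ 0 (suc y) (map suc w)) (cong bump (trans (D-cong suc (λ i → i) (y ∷ w) λ _ _ → refl)
    (trans (cong D (map-id (y ∷ w))) Dπ≡)))

-- At `q = 0` both sides are 0 by the convention of `divℚ`.
divℚ-* : ∀ p q → divℚ p q ≡ p * divℚ 1ℚ q
divℚ-* p q with q ℚ.≟ 0ℚ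
... | yes _ = sym (ℚ.*-zeroʳ p)
... | no  _ = cong (p *_) (sym (ℚ.*-identityˡ _))

*-divℚ-1 : ∀ q → 0ℚ < q → q * divℚ 1ℚ q ≡ 1ℚ
*-divℚ-1 q 0<q with q ℚ.≟ 0ℚ
... | yes q≡0 = ⊥-elim (ℚ.<-irrefl (sym q≡0) 0<q)
... | no  q≢0 = trans (cong (q *_) (ℚ.*-identityˡ _)) (ℚ.*-inverseʳ q {{_}})

divℚ-1-nonneg : ∀ q → 0ℚ < q → 0ℚ ≤ divℚ 1ℚ q
divℚ-1-nonneg q 0<q with q ℚ.≟ 0ℚ
... | yes _ = ℚ.≤-refl
... | no  q≢0 = ℚ.≤-trans (ℚ.<⇒≤ (ℚ.positive⁻¹ ((1/ q) {{≢-nonZero q≢0}}) {{ℚ.1/pos⇒pos q {{positive 0<q}}}}))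
  (ℚ.≤-reflexive (sym (ℚ.*-identityˡ ((1/ q) {{≢-nonZero q≢0}}))))

*-nonneg : ∀ {p q} → 0ℚ ≤ p → 0ℚ ≤ q → 0ℚ ≤ p * q
*-nonneg {p} {q} 0≤p 0≤q = ℚ.≤-trans (ℚ.≤-reflexive (sym (ℚ.*-zeroʳ p)))
  (ℚ.*-monoˡ-≤-nonNeg p {{nonNegative 0≤p}} 0≤q)

≢⇒0< : ∀ {p} → 0ℚ ≤ p → p ≢ 0ℚ → 0ℚ < p
≢⇒0< {p} 0≤p p≢0 with ℚ.<-cmp 0ℚ p
... | tri< 0<p _   _   = 0<p
... | tri≈ _   0≡p _   = ⊥-elim (p≢0 (sym 0≡p))
... | tri> _   _   p<0 = ⊥-elim (p≢0 (ℚ.≤-antisym (ℚ.<⇒≤ p<0) 0≤p))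

∑-indicator : ∀ {A : Set} (_≟_ : DecidableEquality A) {xs : List A} {i} (f : A → ℚ) →
  Unique xs → i ∈ xs → (∑[ xs ] λ x → [ ⌊ i ≟ x ⌋ ]· f x) ≡ f i
∑-indicator _≟_ {x ∷ xs} {i} f (x∉ ∷ xs!) i∈ = trans (∑-∷ x xs _) (split i∈)
  where
  split : i ∈ x ∷ xs → [ ⌊ i ≟ x ⌋ ]· f x + (∑[ xs ] λ y → [ ⌊ i ≟ y ⌋ ]· f y) ≡ f i
  split i∈ with i ≟ x | i∈
  ... | yes refl | _         = trans (cong (f i +_) (∑-≡0 xs λ y y∈ → vanish y (All.lookup x∉ y∈))) (ℚ.+-identityʳ (f i))
    where
    vanish : ∀ y → i ≢ y → [ ⌊ i ≟ y ⌋ ]· f y ≡ 0ℚ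
    vanish y i≢y with i ≟ y
    ... | yes i≡y = ⊥-elim (i≢y i≡y)
    ... | no  _   = refl
  ... | no  i≢x  | here i≡x  = ⊥-elim (i≢x i≡x)
  ... | no  _    | there i∈′ = trans (ℚ.+-identityˡ _) (∑-indicator _≟_ f xs! i∈′)

-- Transition weights between descent classes

module Lumping
  {Φ : List ℕ → List ℕ → ℚ} (Φ-hopf : IsHopfEnd Φ) (n : ℕ) (P : Partitioning Φ n)
  (c : List ℕ → List ℕ → ℚ) (c-coeffs : IsFCoeffs Φ n c)
  where
  open Partitioning P
  open SegmentShuffles Φ-hopf

  inClass : Fin k → List ℕ → Bool
  inClass B σ = ⌊ cls (D σ) ≟ B ⌋

  D-perm∈comps : ∀ {w} → w ∈ perms n → D w ∈ comps n
  D-perm∈comps {w} w∈ = subst (λ m → D w ∈ comps m) (length-perm (∈perms⇒↭ n w∈)) (D∈comps w)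

  ΦF≡Ψ : ∀ {w} γ → w ∈ perms n → ΦF Φ n (D w) γ ≡ Ψ w γ
  ΦF≡Ψ {w} γ w∈ = trans (sym (∑≡Σ (filterᵇ (D w ≤ᶜ_) (comps n)) _))
    (cong (λ m → ∑[ comps m ∣ (D w ≤ᶜ_) ] λ δ → Φ δ γ) (sym (length-perm (∈perms⇒↭ n w∈))))

  ψ≡c : ∀ {w} → w ∈ perms n → ψ w ≡ c (D w) (top n)
  ψ≡c {w} w∈ = begin
    ψ w                                       ≡⟨ cong (Ψ w ∘ top) (length-perm (∈perms⇒↭ n w∈)) ⟩
    Ψ w (top n)                               ≡⟨ ΦF≡Ψ (top n) w∈ ⟨
    ΦF Φ n (D w) (top n)                      ≡⟨ c-coeffs (D w) (top n) (D-perm∈comps w∈) (IsComp⇒∈comps (IsComp-top n)) ⟨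
    (Σ[ comps n ∣ (_≤ᶜ top n) ] c (D w))      ≡⟨ ∑≡Σ _ _ ⟨
    (∑[ comps n ∣ (_≤ᶜ top n) ] c (D w))      ≡⟨ ∑-≤top n (c (D w)) ⟩
    c (D w) (top n)                           ∎

  step : List ℕ → List ℕ → List ℕ
  step π τ = inv (τ ∘ₚ inv π)

  step∈perms : ∀ {π τ} → π ∈ perms n → τ ∈ perms n → step π τ ∈ perms n
  step∈perms π∈ τ∈ = ↭⇒∈perms n (inv-perm (∘ₚ-perm (∈perms⇒↭ n τ∈) (inv-perm (∈perms⇒↭ n π∈))))

  -- The numerator of `K n c π τ`, whose denominator is `total`.
  weight : List ℕ → List ℕ → ℚ
  weight π τ = c (D (step π τ)) (top n)

  total : ℚ
  total = Σ[ perms n ] λ σ → c (D σ) (top n)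

  -- Identifies the normalisation of `Prob` with the denominator of the lumped matrix.
  total≡λⁿ : total ≡ lam Φ ^ℚ n
  total≡λⁿ = begin
    total                                   ≡⟨ ∑≡Σ (perms n) _ ⟨
    (∑[ perms n ] λ σ → c (D σ) (top n))    ≡⟨ ∑-cong (perms n) (λ σ σ∈ → sym (ψ≡c σ∈)) ⟩
    (∑[ perms n ] ψ)                        ≡⟨ cong (λ σs → ∑[ σs ] ψ) (perms≡arrangements n) ⟩
    (∑[ arrangements (downFrom n) ] ψ)      ≡⟨ ∑-arrangements-ψ (Unique.downFrom⁺ n) ⟩
    lam Φ ^ℚ length (downFrom n)            ≡⟨ cong (lam Φ ^ℚ_) (length-downFrom n) ⟩
    lam Φ ^ℚ n                              ∎

  ∑-weight : ∀ {π} → π ∈ perms n → (∑[ perms n ] weight π) ≡ lam Φ ^ℚ n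
  ∑-weight π∈ = trans (∑-cong (perms n) λ τ τ∈ → sym (ψ≡c (step∈perms π∈ τ∈))) (∑-perms-ψ {n} π∈)

  ΦF≡∑-weight : ∀ {π} → π ∈ perms n → ∀ {γ} → γ ∈ comps n →
    ΦF Φ n (D π) γ ≡ (∑[ perms n ] λ τ → [ D τ ≤ᶜ γ ]· weight π τ)
  ΦF≡∑-weight {π} π∈ {γ} γ∈ = trans (ΦF≡Ψ γ π∈) (trans (Ψ≡∑-perms {n} π∈ (∈comps⇒IsComp n γ∈))
    (∑-cong (perms n) λ τ τ∈ → cong ([ D τ ≤ᶜ γ ]·_) (ψ≡c (step∈perms π∈ τ∈))))

  classWeight : List ℕ → Fin k → ℚ
  classWeight π B = ∑[ perms n ∣ inClass B ] weight π

  ∑-classes : ∀ (f : Fin k → ℚ) i → (∑[ allFin k ] λ B → [ ⌊ i ≟ B ⌋ ]· f B) ≡ f i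
  ∑-classes f i = ∑-indicator _≟_ f (Unique.allFin⁺ k) (∈-allFin i)

  -- Serves twice: with the coefficients of φ for the expansion of Φ(φ_A), and with a constant for
  -- the row sums.
  ∑-classWeight : ∀ π (f : Fin k → ℚ) →
    (∑[ allFin k ] λ B → classWeight π B * f B) ≡ (∑[ perms n ] λ τ → weight π τ * f (cls (D τ)))
  ∑-classWeight π f = begin
    (∑[ allFin k ] λ B → classWeight π B * f B)
      ≡⟨ ∑-cong′ (allFin k) (λ B → cong (_* f B) (∑-filter (inClass B) (perms n) (weight π))) ⟩
    (∑[ allFin k ] λ B → (∑[ perms n ] λ τ → [ inClass B τ ]· weight π τ) * f B)
      ≡⟨ ∑-cong′ (allFin k) (λ B → sym (∑-*ʳ (perms n) (f B) _)) ⟩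
    (∑[ allFin k ] λ B → ∑[ perms n ] λ τ → [ inClass B τ ]· weight π τ * f B)
      ≡⟨ ∑-swap (allFin k) (perms n) _ ⟩
    (∑[ perms n ] λ τ → ∑[ allFin k ] λ B → [ inClass B τ ]· weight π τ * f B)
      ≡⟨ ∑-cong′ (perms n) (λ τ → ∑-cong′ (allFin k) λ B →
           trans (sym ([]·-*ʳ (inClass B τ) (weight π τ) (f B))) ([]·-*ˡ (inClass B τ) (weight π τ) (f B))) ⟩
    (∑[ perms n ] λ τ → ∑[ allFin k ] λ B → weight π τ * [ inClass B τ ]· f B)
      ≡⟨ ∑-cong′ (perms n) (λ τ → trans (∑-*ˡ (allFin k) (weight π τ) _)
           (cong (weight π τ *_) (∑-classes f (cls (D τ))))) ⟩
    (∑[ perms n ] λ τ → weight π τ * f (cls (D τ))) ∎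

  rep-constant : ∀ {α} → α ∈ comps n → ∀ {γ} → γ ∈ comps n → φ (cls α) γ ≡ ΦF Φ n α γ
  rep-constant α∈ γ∈ = constant _ _ (rep∈ _) α∈ (repCls _) _ γ∈

  -- Φ is applied to the expansion of Φ(F_D(π)) in the F_D(τ). Each Φ(F_D(τ)) is the φ of the class
  -- of D(τ), so the terms collect by class.
  Φφ≡∑-classWeight : ∀ {π} → π ∈ perms n → ∀ {γ} → γ ∈ comps n →
    (∑[ comps n ] λ δ → φ (cls (D π)) δ * Φ δ γ) ≡ (∑[ allFin k ] λ B → classWeight π B * φ B γ)
  Φφ≡∑-classWeight {π} π∈ {γ} γ∈ = begin
    (∑[ comps n ] λ δ → φ (cls (D π)) δ * Φ δ γ)
      ≡⟨ ∑-cong (comps n) (λ δ δ∈ → cong (_* Φ δ γ)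
           (trans (rep-constant (D-perm∈comps π∈) δ∈) (ΦF≡∑-weight π∈ δ∈))) ⟩
    (∑[ comps n ] λ δ → (∑[ perms n ] λ τ → [ D τ ≤ᶜ δ ]· weight π τ) * Φ δ γ)
      ≡⟨ ∑-cong′ (comps n) (λ δ → sym (∑-*ʳ (perms n) (Φ δ γ) _)) ⟩
    (∑[ comps n ] λ δ → ∑[ perms n ] λ τ → [ D τ ≤ᶜ δ ]· weight π τ * Φ δ γ)
      ≡⟨ ∑-swap (comps n) (perms n) _ ⟩
    (∑[ perms n ] λ τ → ∑[ comps n ] λ δ → [ D τ ≤ᶜ δ ]· weight π τ * Φ δ γ)
      ≡⟨ ∑-cong′ (perms n) (λ τ → ∑-cong′ (comps n) λ δ →
           trans (sym ([]·-*ʳ (D τ ≤ᶜ δ) (weight π τ) (Φ δ γ))) ([]·-*ˡ (D τ ≤ᶜ δ) (weight π τ) (Φ δ γ))) ⟩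
    (∑[ perms n ] λ τ → ∑[ comps n ] λ δ → weight π τ * [ D τ ≤ᶜ δ ]· Φ δ γ)
      ≡⟨ ∑-cong (perms n) (λ τ τ∈ → trans (∑-*ˡ (comps n) (weight π τ) _) (cong (weight π τ *_) (begin
           (∑[ comps n ] λ δ → [ D τ ≤ᶜ δ ]· Φ δ γ) ≡⟨ ∑-filter (D τ ≤ᶜ_) (comps n) _ ⟨
           (∑[ comps n ∣ (D τ ≤ᶜ_) ] λ δ → Φ δ γ)   ≡⟨ ∑≡Σ _ _ ⟩
           ΦF Φ n (D τ) γ                           ≡⟨ rep-constant (D-perm∈comps τ∈) γ∈ ⟨
           φ (cls (D τ)) γ                          ∎))) ⟩
    (∑[ perms n ] λ τ → weight π τ * φ (cls (D τ)) γ)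
      ≡⟨ ∑-classWeight π (λ B → φ B γ) ⟨
    (∑[ allFin k ] λ B → classWeight π B * φ B γ) ∎

  φ-coefficients-unique : ∀ (a b : Fin k → ℚ) →
    (∀ γ → γ ∈ comps n → (∑[ allFin k ] λ B → a B * φ B γ) ≡ (∑[ allFin k ] λ B → b B * φ B γ)) →
    ∀ B → a B ≡ b B
  φ-coefficients-unique a b eq B = begin
    a B                ≡⟨ undo (a B) (b B) ⟩
    (a B - b B) + b B  ≡⟨ cong (_+ b B) (independent (λ B → a B - b B) difference B) ⟩
    0ℚ + b B           ≡⟨ ℚ.+-identityˡ (b B) ⟩
    b B                ∎
    where
    open +-*-Solver
    undo : ∀ p q → p ≡ (p - q) + q
    undo = solve 2 (λ p q → p := (p :- q) :+ q) refl
    distrib : ∀ p q r → (p - q) * r ≡ p * r + (- 1ℚ) * (q * r)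
    distrib = solve 3 (λ p q r → (p :- q) :* r := p :* r :+ con (- 1ℚ) :* (q :* r)) refl
    cancel : ∀ p → p + (- 1ℚ) * p ≡ 0ℚ
    cancel = solve 1 (λ p → p :+ con (- 1ℚ) :* p := con 0ℚ) refl
    difference : ∀ γ → γ ∈ comps n → (Σ[ allFin k ] λ B → (a B - b B) * φ B γ) ≡ 0ℚ
    difference γ γ∈ = begin
      (Σ[ allFin k ] λ B → (a B - b B) * φ B γ)
        ≡⟨ ∑≡Σ (allFin k) _ ⟨
      (∑[ allFin k ] λ B → (a B - b B) * φ B γ)
        ≡⟨ ∑-cong′ (allFin k) (λ B → distrib (a B) (b B) (φ B γ)) ⟩
      (∑[ allFin k ] λ B → a B * φ B γ + (- 1ℚ) * (b B * φ B γ))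
        ≡⟨ trans (∑-+ (allFin k) _ _) (cong₂ _+_ (eq γ γ∈) (∑-*ˡ (allFin k) (- 1ℚ) _)) ⟩
      (∑[ allFin k ] λ B → b B * φ B γ) + (- 1ℚ) * (∑[ allFin k ] λ B → b B * φ B γ)
        ≡⟨ cancel (∑[ allFin k ] λ B → b B * φ B γ) ⟩
      0ℚ ∎

  module _
    (c-nonneg : ∀ α → α ∈ comps n → 0ℚ ≤ c α (top n))
    (c-nonzero : Σ (List ℕ) λ α → α ∈ comps n × c α (top n) ≢ 0ℚ)
    where

    -- The nonzero c_{α,(n)} occurs as a term because some permutation has descent composition `α`;
    -- it bounds the sum from below.
    total-positive : 0ℚ < total
    total-positive =
      let α , α∈ , cα≢0 = c-nonzero
          π , π↭ , Dπ≡α = D-surjective (∈comps⇒IsComp n α∈)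
      in ℚ.<-≤-trans
        (subst (λ δ → 0ℚ < c δ (top n)) (sym Dπ≡α) (≢⇒0< (c-nonneg α α∈) cα≢0))
        (ℚ.≤-trans (term≤∑ (perms n) (λ σ σ∈ → c-nonneg (D σ) (D-perm∈comps σ∈)) (↭⇒∈perms n π↭))
                   (ℚ.≤-reflexive (∑≡Σ (perms n) _)))

    λⁿ-positive : 0ℚ < lam Φ ^ℚ n
    λⁿ-positive = subst (0ℚ <_) total≡λⁿ total-positive

    module _
      (d : Fin k → Fin k → ℚ)
      (d-coeffs : ∀ A γ → γ ∈ comps n →
        (Σ[ comps n ] λ δ → φ A δ * Φ δ γ) ≡ (Σ[ allFin k ] λ B → d A B * φ B γ))
      where

      Khat : Fin k → Fin k → ℚ
      Khat A B = divℚ (d A B) (lam Φ ^ℚ n)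

      -- Compares two expansions of Φ(φ_A) in the basis φ. Lumpability is contained here: the left
      -- side depends on `π` only through the class of `D π`.
      d≡classWeight : ∀ {π} → π ∈ perms n → ∀ B → d (cls (D π)) B ≡ classWeight π B
      d≡classWeight {π} π∈ = φ-coefficients-unique (d (cls (D π))) (classWeight π) λ γ γ∈ →
        trans (∑≡Σ (allFin k) _) (trans (sym (d-coeffs (cls (D π)) γ γ∈))
          (trans (sym (∑≡Σ (comps n) _)) (Φφ≡∑-classWeight π∈ γ∈)))

      Khat≡ : ∀ {π} → π ∈ perms n → ∀ B → Khat (cls (D π)) B ≡ classWeight π B * divℚ 1ℚ (lam Φ ^ℚ n)
      Khat≡ {π} π∈ B = trans (divℚ-* (d (cls (D π)) B) (lam Φ ^ℚ n)) (cong (_* divℚ 1ℚ (lam Φ ^ℚ n)) (d≡classWeight π∈ B))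

      representative : ∀ A → ∃[ π ] (π ∈ perms n × cls (D π) ≡ A)
      representative A with D-surjective (∈comps⇒IsComp n (rep∈ A))
      ... | π , π↭ , Dπ≡rep = π , ↭⇒∈perms n π↭ , trans (cong cls Dπ≡rep) (repCls A)

      Khat-nonneg : ∀ A B → 0ℚ ≤ Khat A B
      Khat-nonneg A B with representative A
      ... | π , π∈ , refl = ℚ.≤-trans
        (*-nonneg (∑-nonneg (filterᵇ (inClass B) (perms n)) λ τ τ∈ → c-nonneg _ (D-perm∈comps
                    (step∈perms π∈ (proj₁ (∈-filter⁻ (T? ∘ inClass B) {xs = perms n} τ∈)))))
                  (divℚ-1-nonneg _ λⁿ-positive))
        (ℚ.≤-reflexive (sym (Khat≡ π∈ B)))

      Khat-row-sum : ∀ A → (Σ[ allFin k ] λ B → Khat A B) ≡ 1ℚ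
      Khat-row-sum A with representative A
      ... | π , π∈ , refl = begin
        (Σ[ allFin k ] λ B → Khat (cls (D π)) B)
          ≡⟨ ∑≡Σ (allFin k) _ ⟨
        (∑[ allFin k ] λ B → Khat (cls (D π)) B)
          ≡⟨ ∑-cong′ (allFin k) (Khat≡ π∈) ⟩
        (∑[ allFin k ] λ B → classWeight π B * divℚ 1ℚ (lam Φ ^ℚ n))
          ≡⟨ ∑-classWeight π (λ _ → divℚ 1ℚ (lam Φ ^ℚ n)) ⟩
        (∑[ perms n ] λ τ → weight π τ * divℚ 1ℚ (lam Φ ^ℚ n))
          ≡⟨ ∑-*ʳ (perms n) (divℚ 1ℚ (lam Φ ^ℚ n)) (weight π) ⟩
        (∑[ perms n ] weight π) * divℚ 1ℚ (lam Φ ^ℚ n)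
          ≡⟨ cong (_* divℚ 1ℚ (lam Φ ^ℚ n)) (∑-weight π∈) ⟩
        (lam Φ ^ℚ n) * divℚ 1ℚ (lam Φ ^ℚ n)
          ≡⟨ *-divℚ-1 _ λⁿ-positive ⟩
        1ℚ ∎

      ∑-K≡Khat : ∀ {π} → π ∈ perms n → ∀ B →
        (Σ[ perms n ∣ inClass B ] λ σ → K n c π σ) ≡ Khat (cls (D π)) B
      ∑-K≡Khat {π} π∈ B = begin
        (Σ[ perms n ∣ inClass B ] λ σ → K n c π σ)
          ≡⟨ ∑≡Σ (filterᵇ (inClass B) (perms n)) _ ⟨
        (∑[ perms n ∣ inClass B ] λ σ → divℚ (weight π σ) total)
          ≡⟨ ∑-cong′ (filterᵇ (inClass B) (perms n)) (λ σ → divℚ-* (weight π σ) total) ⟩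
        (∑[ perms n ∣ inClass B ] λ σ → weight π σ * divℚ 1ℚ total)
          ≡⟨ ∑-*ʳ (filterᵇ (inClass B) (perms n)) (divℚ 1ℚ total) (weight π) ⟩
        classWeight π B * divℚ 1ℚ total
          ≡⟨ cong (λ q → classWeight π B * divℚ 1ℚ q) total≡λⁿ ⟩
        classWeight π B * divℚ 1ℚ (lam Φ ^ℚ n)
          ≡⟨ Khat≡ π∈ B ⟨
        Khat (cls (D π)) B ∎

theorem3p12 :
  (Φ : List ℕ → List ℕ → ℚ) → IsHopfEnd Φ → (n : ℕ) →
  (P : Partitioning Φ n) →
  let open Partitioning P in
  (c : List ℕ → List ℕ → ℚ) → IsFCoeffs Φ n c →
  (∀ α → α ∈ comps n → 0ℚ ≤ c α (top n)) →
  Σ (List ℕ) (λ α → α ∈ comps n × c α (top n) ≢ 0ℚ) →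
  (d : Fin k → Fin k → ℚ) →
  (∀ A γ → γ ∈ comps n →
    (Σ[ comps n ] λ δ → φ A δ * Φ δ γ) ≡ (Σ[ allFin k ] λ B → d A B * φ B γ)) →
  let Khat : Fin k → Fin k → ℚ
      Khat A B = divℚ (d A B) (lam Φ ^ℚ n)
      inB : Fin k → List ℕ → Bool
      inB B σ = ⌊ cls (D σ) ≟ B ⌋
  in
  (∀ A B → 0ℚ ≤ Khat A B) ×
  (∀ A → (Σ[ allFin k ] λ B → Khat A B) ≡ 1ℚ) ×
  (∀ A B π τ → π ∈ perms n → τ ∈ perms n → cls (D π) ≡ A → cls (D τ) ≡ A →
    ((Σ[ perms n ∣ inB B ] λ σ → K n c π σ) ≡ (Σ[ perms n ∣ inB B ] λ σ → K n c τ σ))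
    × ((Σ[ perms n ∣ inB B ] λ σ → K n c τ σ) ≡ Khat A B))
theorem3p12 Φ Φ-hopf n P c c-coeffs c-nonneg c-nonzero d d-coeffs =
  L.Khat-nonneg c-nonneg c-nonzero d d-coeffs ,
  L.Khat-row-sum c-nonneg c-nonzero d d-coeffs ,
  λ { A B π τ π∈ τ∈ refl τ∈A →
      trans (lump π∈ B) (trans (cong (λ A → L.Khat c-nonneg c-nonzero d d-coeffs A B) (sym τ∈A)) (sym (lump τ∈ B))) ,
      trans (lump τ∈ B) (cong (λ A → L.Khat c-nonneg c-nonzero d d-coeffs A B) τ∈A) }
  where
  module L = Lumping Φ-hopf n P c c-coeffs
  lump = L.∑-K≡Khat c-nonneg c-nonzero d d-coeffs
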